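{- Let $F$ be a field of characteristic zero and $k\ge1$. For all $k$-bounded partitions $\lambda,\eta$, $$\mathcal E^{(k)}[X|Y]\;s^{(k)}_{\lambda/\eta}[X]=\sum_{\rho,\mu\in\mathscr P^{(k)}}\widetilde F^{(k)}_{\eta/\mu}[-Y]\;\widetilde F^{(k)}_{\rho/\lambda}[Y]\;s^{(k)}_{\rho/\mu}[X],\qquad \mathcal E^{(k)}[X|Y]=\sum_{\lambda\in\mathscr P^{(k)}}s^{(k)}_\lambda[X]\,\widetilde F^{(k)}_\lambda[Y].$$
   Context: $\Lambda_F$ is the Hopf algebra of symmetric functions over $F$. $\Lambda_{(k)}=F[h_1,\dots,h_k]\subset\Lambda_F$ is a Hopf subalgebra; its graded Hopf dual under the Hall pairing is the quotient $\Lambda^{(k)}=\Lambda_F/\langle p_j:j>k\rangle=\Lambda_F/\langle m_\nu:\nu_1>k\rangle$, with coproduct $\Delta^\vee$. $\mathscr P^{(k)}$ is the set of $k$-bounded partitions ($\lambda_1\le k$). **$k$-Schur functions.** A $(k+1)$-core is a partition with no hook length equal to $k+1$. The bijection $\mathrm{core}_{k+1}$ from $\mathscr P^{(k)}$ to $(k+1)$-cores is inverse to the map sending a core to the partition whose $i$th part is the number of boxes in row $i$ with hook length $\le k$; the $k$-conjugate of $\lambda$ is $\lambda^{(k)}=\mathrm{core}_{k+1}^{ -1}(\mathrm{core}_{k+1}(\lambda)^t)$. The $k$-Schur functions $s^{(k)}_\lambda$, $\lambda\in\mathscr P^{(k)}$, form the basis of $\Lambda_{(k)}$ determined by $s^{(k)}_\varnothing=1$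 and, for $1\le r\le k$, $h_rs^{(k)}_\alpha=\sum_\beta s^{(k)}_\beta$ over $\beta\in\mathscr P^{(k)}$ with $\alpha\subseteq\beta$, $|\beta/\alpha|=r$, $\beta/\alpha$ a horizontal strip and $\beta^{(k)}/\alpha^{(k)}$ a vertical strip. The dual $k$-Schur functions $\widetilde F^{(k)}_\lambda\in\Lambda^{(k)}$ are the dual basis: $\langle s^{(k)}_\lambda,\widetilde F^{(k)}_\mu\rangle=\delta_{\lambda\mu}$. **Skew elements.** $\Delta(s^{(k)}_\lambda)=\sum_\mu s^{(k)}_{\lambda/\mu}\otimes s^{(k)}_\mu$ and $\Delta^\vee(\widetilde F^{(k)}_\lambda)=\sum_\mu\widetilde F^{(k)}_{\lambda/\mu}\otimes\widetilde F^{(k)}_\mu$. **Reading of the identity.** It is an identity in the degree completion $\prod_n(\Lambda_{(k)}\otimes\Lambda^{(k)})_n$, with $f[X]$ standing for the first tensor factor and $g[Y]$ for the second; $g[-Y]$ denotes the antipode $S^\vee(g)$ of $\Lambda^{(k)}$ (i.e. $p_r\mapsto-p_r$ on representatives). Infinite sums are finite in each degree. -}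

module Defs where

open import Algebra.Bundles using (CommutativeRing)
import Algebra.Definitions.RawMonoid as RawMonoid
open import Data.Bool using (if_then_else_)
open import Data.List using (List; []; _∷_; _++_; map; foldr; filter; length; upTo; concatMap)
import Data.List.Properties as List
open import Data.List.Membership.Propositional using (_∈_; _∉_)
open import Data.List.Relation.Binary.Permutation.Propositional using (_↭_; prep; swap; ↭-refl; ↭-sym; ↭-trans; ↭⇒↭ₛ)
open import Data.List.Relation.Binary.Permutation.Propositional.Properties using (filter-↭)
open import Data.List.Relation.Binary.Pointwise using (Pointwise-≡⇒≡)
open import Data.List.Relation.Unary.All using (All; []; _∷_)
import Data.List.Relation.Unary.All.Properties as All
open import Data.List.Relation.Unary.Linked using (Linked; [])
open import Data.List.Relation.Unary.Sorted.TotalOrder.Properties using (↗↭↗⇒≋)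
open import Data.List.Relation.Unary.Unique.Propositional using (Unique)
open import Data.Nat as ℕ using (ℕ; zero; suc; _∸_; _≤_; _<_; _≥_; z≤n)
import Data.Nat.Properties as ℕ
open import Data.Nat.ListAction using (sum)
open import Data.Nat.ListAction.Properties using (sum-↭; sum-++)
open import Data.List.Sort ℕ.≤-decTotalOrder using (sort; sort-↭; sort-↗)
open import Data.Product using (Σ; ∃; _×_; _,_; proj₁; proj₂; uncurry)
open import Data.Sum using (_⊎_; inj₁; inj₂)
open import Function using (_∘_; _⇔_)
open import Level using (Level; _⊔_)
open import Relation.Binary.PropositionalEquality as ≡ using (_≡_; _≢_)
open import Relation.Nullary using (¬_; Dec; yes; no; does; contradiction)

record IsFieldOfCharZero {c ℓ} (F : CommutativeRing c ℓ) : Set (c ⊔ ℓ) where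
  open CommutativeRing F
  open RawMonoid +-rawMonoid using () renaming (_×_ to _×ᶠ_)
  field
    1≉0      : ¬ 1# ≈ 0#
    inverse  : ∀ x → ¬ x ≈ 0# → ∃ λ y → x * y ≈ 1#
    charZero : ∀ n → ¬ (suc n ×ᶠ 1#) ≈ 0#

-- Rows, columns and parts are indexed from 0.  Partitions are
-- lists of positive parts; part pads them with zeros.

part : List ℕ → ℕ → ℕ
part []      _       = 0
part (x ∷ _) zero    = x
part (_ ∷ a) (suc i) = part a i

record IsPartition (a : List ℕ) : Set where
  constructor mkIsPartition
  field
    decreasing : Linked _≥_ a
    positive   : All (0 <_) a

record Partition : Set where
  constructor mkPartition
  field
    parts       : List ℕ
    isPartition : IsPartition parts
open Partition public

record BoundedPartition (k : ℕ) : Set where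
  constructor mkBounded
  field
    partition : Partition
    bounded   : part (parts partition) 0 ≤ k
open BoundedPartition public

bparts : ∀ {k} → BoundedPartition k → List ℕ
bparts = parts ∘ partition

∅ : ∀ {k} → BoundedPartition k
∅ = mkBounded (mkPartition [] (mkIsPartition [] [])) z≤n

transpose : List ℕ → List ℕ
transpose a = map (λ j → length (filter (j ℕ.<?_) a)) (upTo (part a 0))

-- The hook length of the box in row i and column j: arm and the box itself,
-- plus leg.
hook : List ℕ → ℕ → ℕ → ℕ
hook a i j = (part a i ∸ j) ℕ.+ (part (transpose a) j ∸ suc i)

record IsCore (k : ℕ) (a : List ℕ) : Set where
  field
    isPartition : IsPartition a
    noHook      : ∀ i j → j < part a i → hook a i j ≢ suc k

-- core_{k+1}⁻¹, on the parts of a (k+1)-core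
core⁻¹ : ℕ → List ℕ → List ℕ
core⁻¹ k a = map (λ i → length (filter (λ j → hook a i j ℕ.≤? k) (upTo (part a i))))
                 (upTo (length a))

-- The second partition is the k-conjugate of the first.  As core⁻¹ is a
-- bijection on (k+1)-cores, the core a is core_{k+1}(λ).
KConjugate : ∀ {k} → BoundedPartition k → BoundedPartition k → Set
KConjugate {k} la la^ =
  ∃ λ a → IsCore k a × core⁻¹ k a ≡ bparts la × core⁻¹ k (transpose a) ≡ bparts la^

infix 4 _⊆ᵖ_

_⊆ᵖ_ : List ℕ → List ℕ → Set
a ⊆ᵖ b = ∀ i → part a i ≤ part b i

HorizontalStrip : List ℕ → List ℕ → Set
HorizontalStrip b a = a ⊆ᵖ b × (∀ j → part (transpose b) j ≤ suc (part (transpose a) j))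

VerticalStrip : List ℕ → List ℕ → Set
VerticalStrip b a = a ⊆ᵖ b × (∀ i → part b i ≤ suc (part a i))

PieriCover : ∀ {k} → ℕ → BoundedPartition k → BoundedPartition k → Set
PieriCover r α β =
    bparts α ⊆ᵖ bparts β
  × sum (bparts β) ≡ r ℕ.+ sum (bparts α)
  × HorizontalStrip (bparts β) (bparts α)
  × ∃ λ α^ → ∃ λ β^ → KConjugate α α^ × KConjugate β β^ × VerticalStrip (bparts β^) (bparts α^)

-- An exponent list a₁,…,aₙ stands for x₁^a₁ ⋯ xₙ^aₙ.

-- All factorisations of a monomial into two monomials
splits : List ℕ → List (List ℕ × List ℕ)
splits []      = ([] , []) ∷ []
splits (n ∷ a) =
  concatMap (λ i → map (λ (b , c) → (i ∷ b , (n ∸ i) ∷ c)) (splits a)) (upTo (suc n))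

support : List ℕ → List ℕ
support = filter (0 ℕ.<?_)

-- a is a rearrangement of (ν₁,…,ν_ℓ,0,0,…)
_IsRearrangementOf?_ : (a ν : List ℕ) → Dec (sort (support a) ≡ sort (support ν))
a IsRearrangementOf? ν = List.≡-dec ℕ._≟_ (sort (support a)) (sort (support ν))

sort-cong : ∀ {a b} → a ↭ b → sort a ≡ sort b
sort-cong {a} {b} p = Pointwise-≡⇒≡ (↗↭↗⇒≋ ℕ.≤-totalOrder (sort-↗ a) (sort-↗ b)
  (↭⇒↭ₛ (↭-trans (sort-↭ a) (↭-trans p (↭-sym (sort-↭ b))))))

support-0 : ∀ a → support (a ++ 0 ∷ []) ≡ support a
support-0 a = ≡.trans (List.filter-++ (0 ℕ.<?_) a (0 ∷ [])) (List.++-identityʳ (support a))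

sum-support : ∀ a → sum (support a) ≡ sum a
sum-support []          = ≡.refl
sum-support (zero ∷ a)  = sum-support a
sum-support (suc n ∷ a) = ≡.cong (suc n ℕ.+_) (sum-support a)

sum-0 : ∀ a → sum (a ++ 0 ∷ []) ≡ sum a
sum-0 a = ≡.trans (sum-++ a (0 ∷ [])) (ℕ.+-identityʳ (sum a))

sum-sort-support : ∀ a → sum (sort (support a)) ≡ sum a
sum-sort-support a = ≡.trans (sum-↭ (sort-↭ (support a))) (sum-support a)

module SymmetricFunctions {c ℓ} (F : CommutativeRing c ℓ) where

  open CommutativeRing F hiding (zero)
  open import Relation.Binary.Reasoning.Setoid setoid
  open import Algebra.Properties.CommutativeSemigroup +-commutativeSemigroup using (interchange)

  ∑ : ∀ {i} {I : Set i} → List I → (I → Carrier) → Carrier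
  ∑ L t = foldr (λ i r → t i + r) 0# L

  ⟦_⟧ : ∀ {p} {P : Set p} → Dec P → Carrier
  ⟦ P? ⟧ = if does P? then 1# else 0#

  δ : ∀ {k} → BoundedPartition k → BoundedPartition k → Carrier
  δ la mu = ⟦ List.≡-dec ℕ._≟_ (bparts la) (bparts mu) ⟧

  -- Formal power series in x₁,x₂,…, and in x₁,x₂,…,y₁,y₂,…, given by their
  -- coefficients.  Trailing zero exponents do not change the monomial, so the
  -- coefficients must not depend on them: see stable below.
  Series : Set c
  Series = List ℕ → Carrier

  Series₂ : Set c
  Series₂ = List ℕ → List ℕ → Carrier

  convolve : Series → Series → Series
  convolve f g a = ∑ (splits a) (λ (b , c) → f b * g c)

  Inv₂ : (List ℕ → List ℕ → Carrier) → Set ℓ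
  Inv₂ φ = ∀ {a b c d} → a ↭ b → c ↭ d → φ a c ≈ φ b d

  ∑-cong : ∀ {i} {I : Set i} (L : List I) {t u : I → Carrier} → (∀ i → t i ≈ u i) → ∑ L t ≈ ∑ L u
  ∑-cong []      p = refl
  ∑-cong (i ∷ L) p = +-cong (p i) (∑-cong L p)

  ∑-0 : ∀ {i} {I : Set i} (L : List I) → ∑ L (λ _ → 0#) ≈ 0#
  ∑-0 []      = refl
  ∑-0 (i ∷ L) = trans (+-identityˡ _) (∑-0 L)

  ∑-++ : ∀ {i} {I : Set i} (L M : List I) t → ∑ (L ++ M) t ≈ ∑ L t + ∑ M t
  ∑-++ []      M t = sym (+-identityˡ _)
  ∑-++ (i ∷ L) M t = trans (+-congˡ (∑-++ L M t)) (sym (+-assoc _ _ _))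

  ∑-map : ∀ {i j} {I : Set i} {J : Set j} (h : I → J) (L : List I) t → ∑ (map h L) t ≈ ∑ L (t ∘ h)
  ∑-map h []      t = refl
  ∑-map h (i ∷ L) t = +-congˡ (∑-map h L t)

  ∑-concatMap : ∀ {i j} {I : Set i} {J : Set j} (h : I → List J) (L : List I) t →
                ∑ (concatMap h L) t ≈ ∑ L (λ i → ∑ (h i) t)
  ∑-concatMap h []      t = refl
  ∑-concatMap h (i ∷ L) t = trans (∑-++ (h i) (concatMap h L) t) (+-congˡ (∑-concatMap h L t))

  ∑-+ : ∀ {i} {I : Set i} (L : List I) t u → ∑ L (λ i → t i + u i) ≈ ∑ L t + ∑ L u
  ∑-+ []      t u = sym (+-identityˡ _)
  ∑-+ (i ∷ L) t u = trans (+-congˡ (∑-+ L t u)) (interchange _ _ _ _)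

  ∑-swap : ∀ {i j} {I : Set i} {J : Set j} (L : List I) (M : List J) (t : I → J → Carrier) →
           ∑ L (λ i → ∑ M (t i)) ≈ ∑ M (λ j → ∑ L (λ i → t i j))
  ∑-swap []      M t = sym (∑-0 M)
  ∑-swap (i ∷ L) M t = trans (+-congˡ (∑-swap L M t)) (sym (∑-+ M _ _))

  ∑-splits : ∀ n a φ → ∑ (splits (n ∷ a)) φ ≈
             ∑ (upTo (suc n)) (λ i → ∑ (splits a) (λ (b , c) → φ (i ∷ b , (n ∸ i) ∷ c)))
  ∑-splits n a φ = trans (∑-concatMap (λ i → map (extend i) (splits a)) (upTo (suc n)) φ)
    (∑-cong (upTo (suc n)) (λ i → ∑-map (extend i) (splits a) φ))
    where
    extend : ℕ → List ℕ × List ℕ → List ℕ × List ℕ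
    extend i (b , c) = i ∷ b , (n ∸ i) ∷ c

  ∑-splits-↭ : ∀ {a b} → a ↭ b → ∀ φ → Inv₂ φ → ∑ (splits a) (uncurry φ) ≈ ∑ (splits b) (uncurry φ)
  ∑-splits-↭ _↭_.refl φ inv = refl
  ∑-splits-↭ (prep {xs = a} {ys = b} n p) φ inv = begin
    ∑ (splits (n ∷ a)) (uncurry φ)
      ≈⟨ ∑-splits n a _ ⟩
    ∑ (upTo (suc n)) (λ i → ∑ (splits a) (λ (b , c) → φ (i ∷ b) ((n ∸ i) ∷ c)))
      ≈⟨ ∑-cong (upTo (suc n)) (λ i → ∑-splits-↭ p (λ b c → φ (i ∷ b) ((n ∸ i) ∷ c))
           (λ q r → inv (prep _ q) (prep _ r))) ⟩
    ∑ (upTo (suc n)) (λ i → ∑ (splits b) (λ (b , c) → φ (i ∷ b) ((n ∸ i) ∷ c)))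
      ≈⟨ ∑-splits n b _ ⟨
    ∑ (splits (n ∷ b)) (uncurry φ) ∎
  ∑-splits-↭ (swap {xs = a} {ys = b} m n p) φ inv = begin
    ∑ (splits (m ∷ n ∷ a)) (uncurry φ)
      ≈⟨ ∑-splits m (n ∷ a) _ ⟩
    ∑ (upTo (suc m)) (λ i → ∑ (splits (n ∷ a)) (λ (b , c) → φ (i ∷ b) ((m ∸ i) ∷ c)))
      ≈⟨ ∑-cong (upTo (suc m)) (λ i → ∑-splits n a _) ⟩
    ∑ (upTo (suc m)) (λ i → ∑ (upTo (suc n)) (λ j → ∑ (splits a)
      (λ (b , c) → φ (i ∷ j ∷ b) ((m ∸ i) ∷ (n ∸ j) ∷ c))))
      ≈⟨ ∑-swap (upTo (suc m)) (upTo (suc n)) _ ⟩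
    ∑ (upTo (suc n)) (λ j → ∑ (upTo (suc m)) (λ i → ∑ (splits a)
      (λ (b , c) → φ (i ∷ j ∷ b) ((m ∸ i) ∷ (n ∸ j) ∷ c))))
      ≈⟨ ∑-cong (upTo (suc n)) (λ j → ∑-cong (upTo (suc m)) (λ i → trans
           (∑-splits-↭ p (λ b c → φ (i ∷ j ∷ b) ((m ∸ i) ∷ (n ∸ j) ∷ c))
             (λ q r → inv (prep _ (prep _ q)) (prep _ (prep _ r))))
           (∑-cong (splits b) (λ _ → inv (swap _ _ ↭-refl) (swap _ _ ↭-refl))))) ⟩
    ∑ (upTo (suc n)) (λ j → ∑ (upTo (suc m)) (λ i → ∑ (splits b)
      (λ (b , c) → φ (j ∷ i ∷ b) ((n ∸ j) ∷ (m ∸ i) ∷ c))))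
      ≈⟨ ∑-cong (upTo (suc n)) (λ j → ∑-splits m b _) ⟨
    ∑ (upTo (suc n)) (λ j → ∑ (splits (m ∷ b)) (λ (b , c) → φ (j ∷ b) ((n ∸ j) ∷ c)))
      ≈⟨ ∑-splits n (m ∷ b) _ ⟨
    ∑ (splits (n ∷ m ∷ b)) (uncurry φ) ∎
  ∑-splits-↭ (_↭_.trans p q) φ inv = trans (∑-splits-↭ p φ inv) (∑-splits-↭ q φ inv)

  ∑-splits-0 : ∀ a φ → (∀ b c → φ (b ++ 0 ∷ []) (c ++ 0 ∷ []) ≈ φ b c) →
               ∑ (splits (a ++ 0 ∷ [])) (uncurry φ) ≈ ∑ (splits a) (uncurry φ)
  ∑-splits-0 []      φ inv = +-congʳ (inv [] [])
  ∑-splits-0 (n ∷ a) φ inv = begin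
    ∑ (splits (n ∷ a ++ 0 ∷ [])) (uncurry φ)
      ≈⟨ ∑-splits n (a ++ 0 ∷ []) _ ⟩
    ∑ (upTo (suc n)) (λ i → ∑ (splits (a ++ 0 ∷ [])) (λ (b , c) → φ (i ∷ b) ((n ∸ i) ∷ c)))
      ≈⟨ ∑-cong (upTo (suc n)) (λ i → ∑-splits-0 a (λ b c → φ (i ∷ b) ((n ∸ i) ∷ c))
           (λ b c → inv (i ∷ b) ((n ∸ i) ∷ c))) ⟩
    ∑ (upTo (suc n)) (λ i → ∑ (splits a) (λ (b , c) → φ (i ∷ b) ((n ∸ i) ∷ c)))
      ≈⟨ ∑-splits n a _ ⟨
    ∑ (splits (n ∷ a)) (uncurry φ) ∎

  ∑-upTo-0 : ∀ n (t : ℕ → Carrier) → (∀ i → i < n → t i ≈ 0#) → ∑ (upTo n) t ≈ 0#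
  ∑-upTo-0 n t p = go (All.applyUpTo⁺₁ (λ i → i) n (λ {i} i<n → p i i<n))
    where
    go : ∀ {L} → All (λ i → t i ≈ 0#) L → ∑ L t ≈ 0#
    go []       = refl
    go (q ∷ qs) = trans (+-cong q (go qs)) (+-identityˡ _)

  ∑-splits-deg : ∀ a φ → (∀ b c → sum b ℕ.+ sum c ≡ sum a → φ b c ≈ 0#) →
                 ∑ (splits a) (uncurry φ) ≈ 0#
  ∑-splits-deg []      φ p = trans (+-congʳ (p [] [] ≡.refl)) (+-identityˡ _)
  ∑-splits-deg (n ∷ a) φ p = trans (∑-splits n a _) (∑-upTo-0 (suc n) _ (λ i i<1+n →
    ∑-splits-deg a (λ b c → φ (i ∷ b) ((n ∸ i) ∷ c)) (λ b c q → p _ _ (lemma b c (ℕ.≤-pred i<1+n) q))))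
    where
    open import Algebra.Properties.CommutativeSemigroup ℕ.+-commutativeSemigroup
      using () renaming (interchange to ℕ-interchange)
    lemma : ∀ {i} b c → i ≤ n → sum b ℕ.+ sum c ≡ sum a →
            (i ℕ.+ sum b) ℕ.+ ((n ∸ i) ℕ.+ sum c) ≡ n ℕ.+ sum a
    lemma {i} b c i≤n q = ≡.trans (ℕ-interchange i (sum b) (n ∸ i) (sum c))
      (≡.cong₂ ℕ._+_ (ℕ.m+[n∸m]≡n i≤n) q)

  larger : ∀ {d e} m n → d ℕ.+ e < m ℕ.+ n → d < m ⊎ e < n
  larger {d} {e} m n p with d ℕ.<? m
  ... | yes d<m = inj₁ d<m
  ... | no  d≮m = inj₂ (ℕ.≰⇒> (λ n≤e → ℕ.<⇒≱ p (ℕ.+-mono-≤ (ℕ.≮⇒≥ d≮m) n≤e)))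

  record Λ : Set (c ⊔ ℓ) where
    field
      coeff     : Series
      symmetric : ∀ {a b} → a ↭ b → coeff a ≈ coeff b
      stable    : ∀ a → coeff (a ++ 0 ∷ []) ≈ coeff a
      degree    : ℕ
      vanishes  : ∀ a → degree < sum a → coeff a ≈ 0#
  open Λ public

  infix  4 _≈Λ_
  infixl 6 _+Λ_
  infixr 7 _·_
  infixl 7 _*Λ_

  _≈Λ_ : Λ → Λ → Set ℓ
  f ≈Λ g = ∀ a → coeff f a ≈ coeff g a

  0Λ : Λ
  0Λ = record
    { coeff     = λ _ → 0#
    ; symmetric = λ _ → refl
    ; stable    = λ _ → refl
    ; degree    = 0
    ; vanishes  = λ _ _ → refl
    }

  _+Λ_ : Λ → Λ → Λ
  f +Λ g = record
    { coeff     = λ a → coeff f a + coeff g a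
    ; symmetric = λ p → +-cong (symmetric f p) (symmetric g p)
    ; stable    = λ a → +-cong (stable f a) (stable g a)
    ; degree    = degree f ℕ.⊔ degree g
    ; vanishes  = λ a p → trans
        (+-cong (vanishes f a (ℕ.≤-<-trans (ℕ.m≤m⊔n _ _) p))
                (vanishes g a (ℕ.≤-<-trans (ℕ.m≤n⊔m _ _) p)))
        (+-identityˡ _)
    }

  _·_ : Carrier → Λ → Λ
  x · f = record
    { coeff     = λ a → x * coeff f a
    ; symmetric = λ p → *-congˡ (symmetric f p)
    ; stable    = λ a → *-congˡ (stable f a)
    ; degree    = degree f
    ; vanishes  = λ a p → trans (*-congˡ (vanishes f a p)) (zeroʳ x)
    }

  _*Λ_ : Λ → Λ → Λ
  f *Λ g = record
    { coeff     = convolve (coeff f) (coeff g)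
    ; symmetric = λ p → ∑-splits-↭ p _ (λ q r → *-cong (symmetric f q) (symmetric g r))
    ; stable    = λ a → ∑-splits-0 a _ (λ b c → *-cong (stable f b) (stable g c))
    ; degree    = degree f ℕ.+ degree g
    ; vanishes  = λ a p → ∑-splits-deg a _ (λ b c q → product-vanishes b c
        (larger (sum b) (sum c) (≡.subst (degree f ℕ.+ degree g <_) (≡.sym q) p)))
    }
    where
    product-vanishes : ∀ b c → degree f < sum b ⊎ degree g < sum c → coeff f b * coeff g c ≈ 0#
    product-vanishes b c (inj₁ p) = trans (*-congʳ (vanishes f b p)) (zeroˡ _)
    product-vanishes b c (inj₂ p) = trans (*-congˡ (vanishes g c p)) (zeroʳ _)

  ⟦⟧-no : ∀ {p} {P : Set p} (P? : Dec P) → ¬ P → ⟦ P? ⟧ ≈ 0#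
  ⟦⟧-no (yes p) ¬p = contradiction p ¬p
  ⟦⟧-no (no _)  ¬p = refl

  h : ℕ → Λ
  h n = record
    { coeff     = λ a → ⟦ sum a ℕ.≟ n ⟧
    ; symmetric = λ p → reflexive (≡.cong (λ s → ⟦ s ℕ.≟ n ⟧) (sum-↭ p))
    ; stable    = λ a → reflexive (≡.cong (λ s → ⟦ s ℕ.≟ n ⟧) (sum-0 a))
    ; degree    = n
    ; vanishes  = λ a p → ⟦⟧-no (sum a ℕ.≟ n) (λ q → ℕ.<-irrefl (≡.sym q) p)
    }

  1Λ : Λ
  1Λ = h 0

  m : Partition → Λ
  m ν = record
    { coeff     = λ a → ⟦ a IsRearrangementOf? parts ν ⟧
    ; symmetric = λ p → by (sort-cong (filter-↭ (0 ℕ.<?_) p))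
    ; stable    = λ a → by (≡.cong sort (support-0 a))
    ; degree    = sum (parts ν)
    ; vanishes  = λ a p → ⟦⟧-no (a IsRearrangementOf? parts ν) (λ q → ℕ.<-irrefl
        (≡.trans (≡.sym (sum-sort-support (parts ν))) (≡.trans (≡.cong sum (≡.sym q)) (sum-sort-support a))) p)
    }
    where
    by : ∀ {a b} → a ≡ b → ⟦ List.≡-dec ℕ._≟_ a (sort (support (parts ν))) ⟧
                         ≈ ⟦ List.≡-dec ℕ._≟_ b (sort (support (parts ν))) ⟧
    by ≡.refl = refl

  hᵖ : Partition → Λ
  hᵖ la = foldr (λ n f → h n *Λ f) 1Λ (parts la)

  ∑Λ : ∀ {i} {I : Set i} → List I → (I → Λ) → Λ
  ∑Λ L t = foldr (λ i f → t i +Λ f) 0Λ L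

  -- The coproduct f ↦ f[X+Y], as a symmetric function of two alphabets
  Δ : Λ → Series₂
  Δ f a b = coeff f (a ++ b)

  ε : Λ → Carrier
  ε f = coeff f []

  record IsHallPairing (⟨_,_⟩ : Λ → Λ → Carrier) : Set (c ⊔ ℓ) where
    field
      cong  : ∀ {f f₁ g g₁} → f ≈Λ f₁ → g ≈Λ g₁ → ⟨ f , g ⟩ ≈ ⟨ f₁ , g₁ ⟩
      +ˡ    : ∀ f f₁ g → ⟨ f +Λ f₁ , g ⟩ ≈ ⟨ f , g ⟩ + ⟨ f₁ , g ⟩
      +ʳ    : ∀ f g g₁ → ⟨ f , g +Λ g₁ ⟩ ≈ ⟨ f , g ⟩ + ⟨ f , g₁ ⟩
      ·ˡ    : ∀ x f g → ⟨ x · f , g ⟩ ≈ x * ⟨ f , g ⟩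
      ·ʳ    : ∀ x f g → ⟨ f , x · g ⟩ ≈ x * ⟨ f , g ⟩
      dual  : ∀ la mu → ⟨ hᵖ la , m mu ⟩ ≈ ⟦ List.≡-dec ℕ._≟_ (parts la) (parts mu) ⟧

  -- f ⊗ g is f[X] g[Y], as a series in two alphabets

  infixl 7 _⊗_ _⋆_
  infixl 6 _+₂_
  infix  4 _≈₂_

  _⊗_ : Λ → Λ → Series₂
  (f ⊗ g) a b = coeff f a * coeff g b

  _+₂_ : Series₂ → Series₂ → Series₂
  (T +₂ U) a b = T a b + U a b

  0₂ : Series₂
  0₂ _ _ = 0#

  ∑₂ : ∀ {i} {I : Set i} → List I → (I → Series₂) → Series₂
  ∑₂ L t = foldr (λ i T → t i +₂ T) 0₂ L

  _⋆_ : Series₂ → Series₂ → Series₂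
  (T ⋆ U) a b = ∑ (splits a) λ (a₁ , a₂) → ∑ (splits b) λ (b₁ , b₂) → T a₁ b₁ * U a₂ b₂

  _≈₂_ : Series₂ → Series₂ → Set ℓ
  T ≈₂ U = ∀ a b → T a b ≈ U a b

  -- T = Σ_{i ∈ I} t i for a family with only finitely many nonzero members,
  -- with respect to the equality _∼_
  FiniteSum : ∀ {r} {I : Set} → (Series₂ → Series₂ → Set r) → (I → Series₂) → Series₂ → Set r
  FiniteSum _∼_ t T = ∃ λ L → Unique L × (∀ i → i ∉ L → t i ∼ 0₂) × T ∼ ∑₂ L t

  -- The subalgebra Λ₍ₖ₎ and the quotient Λ⁽ᵏ⁾.  Elements of Λ⁽ᵏ⁾ are given by
  -- representatives in Λ, and compared by _≈ᵏ_.

  module _ (k : ℕ) where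

    data Λ₍ₖ₎ : Λ → Set (c ⊔ ℓ) where
      gen   : ∀ r → 1 ≤ r → r ≤ k → Λ₍ₖ₎ (h r)
      one   : Λ₍ₖ₎ 1Λ
      scale : ∀ x {f} → Λ₍ₖ₎ f → Λ₍ₖ₎ (x · f)
      plus  : ∀ {f g} → Λ₍ₖ₎ f → Λ₍ₖ₎ g → Λ₍ₖ₎ (f +Λ g)
      times : ∀ {f g} → Λ₍ₖ₎ f → Λ₍ₖ₎ g → Λ₍ₖ₎ (f *Λ g)
      resp  : ∀ {f g} → f ≈Λ g → Λ₍ₖ₎ f → Λ₍ₖ₎ g

    -- ⟨ m_ν : ν₁ > k ⟩
    data Ideal : Λ → Set (c ⊔ ℓ) where
      null : Ideal 0Λ
      gen  : ∀ f ν → k < part (parts ν) 0 → Ideal (f *Λ m ν)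
      plus : ∀ {f g} → Ideal f → Ideal g → Ideal (f +Λ g)
      resp : ∀ {f g} → f ≈Λ g → Ideal f → Ideal g

    infix 4 _≈ᵏ_ _≈ᵏᵏ_

    _≈ᵏ_ : Λ → Λ → Set (c ⊔ ℓ)
    f ≈ᵏ g = ∃ λ i → Ideal i × f ≈Λ g +Λ i

    -- Equality in Λ⁽ᵏ⁾ ⊗ Λ⁽ᵏ⁾ = (Λ ⊗ Λ) / (I ⊗ Λ + Λ ⊗ I)
    _≈ᵏᵏ_ : Series₂ → Series₂ → Set (c ⊔ ℓ)
    T ≈ᵏᵏ U = ∃ λ (L : List (Λ × Λ)) →
      All (λ (f , g) → Ideal f ⊎ Ideal g) L × T ≈₂ U +₂ ∑₂ L (uncurry _⊗_)

    -- Equality of the components of total degree n in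
    -- Λ₍ₖ₎ ⊗ Λ⁽ᵏ⁾ = (Λ₍ₖ₎ ⊗ Λ) / (Λ₍ₖ₎ ⊗ I)
    EqualInDegree : ℕ → Series₂ → Series₂ → Set (c ⊔ ℓ)
    EqualInDegree n T U = ∃ λ (L : List (Λ × Λ)) →
      All (λ (f , g) → Λ₍ₖ₎ f × Ideal g) L ×
      (∀ a b → sum a ℕ.+ sum b ≡ n → T a b ≈ (U +₂ ∑₂ L (uncurry _⊗_)) a b)

    -- T = Σ_{i ∈ I} t i in the degree completion ∏ₙ (Λ₍ₖ₎ ⊗ Λ⁽ᵏ⁾)ₙ: for every n,
    -- all but finitely many t i have zero component in degree n, and the
    -- components add up to that of T.
    HasSum : {I : Set} → (I → Series₂) → Series₂ → Set (c ⊔ ℓ)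
    HasSum t T = ∀ n → FiniteSum (EqualInDegree n) t T

    record IsBasisOfΛ₍ₖ₎ {I : Set} (s : I → Λ) : Set (c ⊔ ℓ) where
      field
        member      : ∀ i → Λ₍ₖ₎ (s i)
        independent : ∀ L → Unique L → (x : I → Carrier) →
                      ∑Λ L (λ i → x i · s i) ≈Λ 0Λ → ∀ i → i ∈ L → x i ≈ 0#
        spanning    : ∀ f → Λ₍ₖ₎ f → ∃ λ (L : List (Carrier × I)) → f ≈Λ ∑Λ L (λ (x , i) → x · s i)

    record IsKSchur (s : BoundedPartition k → Λ) : Set (c ⊔ ℓ) where
      field
        basis : IsBasisOfΛ₍ₖ₎ s
        empty : s ∅ ≈Λ 1Λ
        pieri : ∀ r → 1 ≤ r → r ≤ k → ∀ α → ∃ λ L →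
                Unique L × (∀ β → β ∈ L ⇔ PieriCover r α β) × h r *Λ s α ≈Λ ∑Λ L s

    IsSkewKSchur : (s : BoundedPartition k → Λ) → (BoundedPartition k → BoundedPartition k → Λ) → Set (c ⊔ ℓ)
    IsSkewKSchur s s/ =
      (∀ la mu → Λ₍ₖ₎ (s/ la mu)) ×
      (∀ la → FiniteSum _≈₂_ (λ mu → s/ la mu ⊗ s mu) (Δ (s la)))

    IsSkewDualKSchur : (F~ : BoundedPartition k → Λ) → (BoundedPartition k → BoundedPartition k → Λ) → Set (c ⊔ ℓ)
    IsSkewDualKSchur F~ F~/ =
      ∀ la → FiniteSum _≈ᵏᵏ_ (λ mu → F~/ la mu ⊗ F~ mu) (Δ (F~ la))

    -- The antipode of the Hopf algebra Λ⁽ᵏ⁾, with Σ S(f₁) f₂ = ε(f) 1 = Σ f₁ S(f₂)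
    -- required for every expression Σ f₁ ⊗ f₂ of the coproduct of f.
    record IsAntipode (S : Λ → Λ) : Set (c ⊔ ℓ) where
      field
        cong     : ∀ {f g} → f ≈ᵏ g → S f ≈ᵏ S g
        additive : ∀ f g → S (f +Λ g) ≈ᵏ S f +Λ S g
        scalar   : ∀ x f → S (x · f) ≈ᵏ x · S f
        inverseˡ : ∀ f (L : List (Λ × Λ)) → Δ f ≈ᵏᵏ ∑₂ L (uncurry _⊗_) →
                   ∑Λ L (λ (f₁ , f₂) → S f₁ *Λ f₂) ≈ᵏ ε f · 1Λ
        inverseʳ : ∀ f (L : List (Λ × Λ)) → Δ f ≈ᵏᵏ ∑₂ L (uncurry _⊗_) →
                   ∑Λ L (λ (f₁ , f₂) → f₁ *Λ S f₂) ≈ᵏ ε f · 1Λ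

{-# OPTIONS --safe #-}

-- Since Λ⁽ᵏ⁾ is dual to Λ₍ₖ₎ = F[h₁,…,hₖ], an element of Λ⁽ᵏ⁾ is determined by its
-- coefficients at the monomials y^b with all bᵢ ≤ k, and ⟨ h_b , g ⟩ is the coefficient
-- of y^b in g.  In these coordinates the kernel E[X|Y] has the coefficient h_b[X] at y^b,
-- and the skew elements become matrix coefficients:
--   s_{ρ/μ}[X] = ⟨ s_ρ[X+Z] , F~_μ[Z] ⟩,   [y^b] F~_{ρ/λ} = ⟨ h_b s_λ , F~_ρ ⟩.
-- Hence ∑_ρ F~_{ρ/λ}[Y] s_ρ[X] = E[X|Y] s_λ[X].  Replacing X by X+Z, and using that the h_b
-- form a coalgebra, the coefficients of s_μ[Z] give
--   ∑_ρ F~_{ρ/λ}[Y] s_{ρ/μ}[X] = E[X|Y] ∑_η s_{λ/η}[X] F~_{μ/η}[Y],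
-- which is inverted by ∑_μ S(F~_{η/μ}) F~_{μ/η′} = δ_{ηη′}, the antipode axiom for F~_{η/η′}.
-- All this needs of the k-Schur functions is that s_λ is homogeneous of degree |λ|, which
-- follows from the Pieri rule by duality.

module Submission where

open import Defs
open import Algebra.Bundles using (CommutativeRing)
open import Data.List using (List; []; _∷_; [_]; _++_; map; foldr; filter; upTo; concatMap; cartesianProduct; deduplicate)
import Data.List.Properties as List
open import Data.List.Membership.Propositional using (_∈_; _∉_)
open import Data.List.Membership.Propositional.Properties
  using (∈-map⁺; ∈-concatMap⁺; ∈-upTo⁺; ∈-deduplicate⁺; ∈-filter⁺; ∈-cartesianProduct⁺)
import Data.List.Membership.DecPropositional as DecMembership
open import Data.List.Relation.Binary.Permutation.Propositional
  using (_↭_; prep; swap; ↭-sym; ↭-trans; ↭-reflexive; ↭⇒↭ₛ)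
open import Data.List.Relation.Binary.Permutation.Propositional.Properties
  using (All-resp-↭; ++⁺ˡ; ++-comm; ∷↭∷ʳ)
open import Data.List.Relation.Binary.Pointwise using (Pointwise-≡⇒≡)
open import Data.List.Relation.Unary.All as All using (All; []; _∷_)
import Data.List.Relation.Unary.All.Properties as All
open import Data.List.Relation.Unary.AllPairs using (_∷_)
open import Data.List.Relation.Unary.Any as Any using (here; there)
open import Data.List.Relation.Unary.Linked as Linked using (Linked; []; [-]; _∷_)
open import Data.List.Relation.Unary.Sorted.TotalOrder.Properties using (↗↭↗⇒≋)
open import Data.List.Relation.Unary.Unique.DecPropositional.Properties using (deduplicate-!)
open import Data.List.Relation.Unary.Unique.Propositional using (Unique)
open import Data.List.Relation.Unary.Unique.Propositional.Properties
  using (upTo⁺; cartesianProduct⁺) renaming (filter⁺ to unique-filter⁺)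
open import Data.Nat as ℕ using (ℕ; zero; suc; _∸_; _≤_; _<_; _≥_; z≤n; s≤s)
open import Data.Nat.ListAction using (sum)
open import Data.Nat.ListAction.Properties using (sum-↭; sum-++)
import Data.Nat.Properties as ℕ
open import Data.Product using (Σ; ∃; _×_; _,_; proj₁; proj₂; uncurry)
open import Data.Sum using (_⊎_; inj₁; inj₂)
open import Data.Unit using (⊤; tt)
open import Function using (_∘_; id; Equivalence)
open import Level using (_⊔_)
open import Relation.Binary.Construct.Flip.EqAndOrd as Flip using ()
open import Relation.Binary.Definitions using (DecidableEquality)
open import Relation.Binary.PropositionalEquality as ≡ using (_≡_; _≢_)
open import Relation.Nullary using (¬_; Dec; yes; no; contradiction)
import Data.List.Sort ℕ.≤-decTotalOrder as Increasing
import Data.List.Sort (Flip.decTotalOrder ℕ.≤-decTotalOrder) as Decreasing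

-- The obstacle is that everything about Λ⁽ᵏ⁾ is stated on representatives: F~_{ρ/λ} and `S` are
-- fixed only modulo the ideal, and each equality asked for needs an explicit correction term in
-- Λ₍ₖ₎ ⊗ I. Both are handled by one criterion: a symmetric function lies in the ideal exactly when
-- its coefficients at all bounded exponent lists vanish. A version for finite tensors feeds the
-- antipode axiom, and one for a fixed total degree produces the corrections in the conclusion. So
-- all computations take place at a fixed pair a, b with b bounded.
--
-- The value of the kernel at unbounded b is then a free choice. Taking it to be zero is compatible
-- with multiplication by s_{λ/η}[X], so the product is again zero there.
--
-- At fixed a and b the sums over partitions are cut off at a common size; the terms left out vanish
-- for degree reasons. The grading used for this must not presuppose that the given s_λ are
-- homogeneous: labels are counted by size, and size is identified with degree only afterwards.

splits-All : ∀ {p} (P : List ℕ → List ℕ → List ℕ → Set p) → P [] [] [] →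
             (∀ {n i a b c} → i ≤ n → P a b c → P (n ∷ a) (i ∷ b) ((n ∸ i) ∷ c)) →
             ∀ a → All (uncurry (P a)) (splits a)
splits-All P nil cons []      = nil ∷ []
splits-All P nil cons (n ∷ a) = All.concat⁺ (All.map⁺ (All.applyUpTo⁺₁ id (suc n)
  (λ i<1+n → All.map⁺ (All.map (cons (ℕ.≤-pred i<1+n)) (splits-All P nil cons a)))))

splits-sum : ∀ a → All (λ (b , c) → sum b ℕ.+ sum c ≡ sum a) (splits a)
splits-sum = splits-All (λ a b c → sum b ℕ.+ sum c ≡ sum a) ≡.refl
  (λ {n} {i} {a} {b} {c} i≤n q → ≡.trans (interchange i (sum b) (n ∸ i) (sum c))
    (≡.cong₂ ℕ._+_ (ℕ.m+[n∸m]≡n i≤n) q))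
  where
  open import Algebra.Properties.CommutativeSemigroup ℕ.+-commutativeSemigroup using (interchange)

-- Factors of a bounded monomial are bounded, so the bounded coefficients of a product depend only
-- on the bounded coefficients of its factors. This makes restriction to bounded exponents
-- compatible with multiplication.
splits-≤ : ∀ {k} a → All (_≤ k) a → All (λ (b , c) → All (_≤ k) b × All (_≤ k) c) (splits a)
splits-≤ {k} a a≤k = All.map (λ f → f a≤k)
  (splits-All (λ a b c → All (_≤ k) a → All (_≤ k) b × All (_≤ k) c) (λ _ → [] , [])
    (λ {n} {i} i≤n f → λ { (n≤k ∷ a≤k) → ℕ.≤-trans i≤n n≤k ∷ proj₁ (f a≤k)
                                   , ℕ.≤-trans (ℕ.m∸n≤m n i) n≤k ∷ proj₂ (f a≤k) }) a)

-- Finite sums and the convolution of power series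

module Convolution {c ℓ} (F : CommutativeRing c ℓ) where

  open CommutativeRing F hiding (zero)
  open SymmetricFunctions F
  open import Relation.Binary.Reasoning.Setoid setoid

  ∑-congᴬ : ∀ {i} {I : Set i} {L : List I} {t u : I → Carrier} →
            All (λ i → t i ≈ u i) L → ∑ L t ≈ ∑ L u
  ∑-congᴬ []       = refl
  ∑-congᴬ (p ∷ ps) = +-cong p (∑-congᴬ ps)

  ∑-zero : ∀ {i} {I : Set i} (L : List I) {t : I → Carrier} → (∀ i → t i ≈ 0#) → ∑ L t ≈ 0#
  ∑-zero L p = trans (∑-cong L p) (∑-0 L)

  *-∑ : ∀ {i} {I : Set i} x (L : List I) (t : I → Carrier) → x * ∑ L t ≈ ∑ L (λ i → x * t i)
  *-∑ x []      t = zeroʳ x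
  *-∑ x (i ∷ L) t = trans (distribˡ _ _ _) (+-congˡ (*-∑ x L t))

  ∑-* : ∀ {i} {I : Set i} (L : List I) (t : I → Carrier) x → ∑ L t * x ≈ ∑ L (λ i → t i * x)
  ∑-* []      t x = zeroˡ x
  ∑-* (i ∷ L) t x = trans (distribʳ _ _ _) (+-congˡ (∑-* L t x))

  ∑-*-∑ : ∀ {i j} {I : Set i} {J : Set j} (L : List I) (M : List J) t u →
          ∑ L t * ∑ M u ≈ ∑ L (λ i → ∑ M (λ j → t i * u j))
  ∑-*-∑ L M t u = trans (∑-* L t _) (∑-cong L (λ i → *-∑ (t i) M u))

  ∑-single : ∀ {i} {I : Set i} {L : List I} {t : I → Carrier} {i} → Unique L → i ∈ L →
             (∀ j → j ≢ i → t j ≈ 0#) → ∑ L t ≈ t i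
  ∑-single {L = _ ∷ L} {t} {i} (i≢ ∷ _) (here ≡.refl) p = trans
    (+-congˡ (trans (∑-congᴬ (All.map (λ i≢j → p _ (i≢j ∘ ≡.sym)) i≢)) (∑-0 L))) (+-identityʳ _)
  ∑-single {t = t} (j≢ ∷ !L) (there i∈L) p =
    trans (+-cong (p _ (All.lookup j≢ i∈L)) (∑-single !L i∈L p)) (+-identityˡ _)

  ∑-none : ∀ {i} {I : Set i} {L : List I} {t : I → Carrier} {i} → i ∉ L →
           (∀ j → j ≢ i → t j ≈ 0#) → ∑ L t ≈ 0#
  ∑-none {L = L} i∉L p = trans
    (∑-congᴬ (All.tabulate (λ {j} j∈L → p j (λ j≡i → i∉L (≡.subst (_∈ L) j≡i j∈L))))) (∑-0 L)

  ∑-cartesianProduct : ∀ {i j} {I : Set i} {J : Set j} (L : List I) (M : List J) t →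
                       ∑ (cartesianProduct L M) t ≈ ∑ L (λ i → ∑ M (λ j → t (i , j)))
  ∑-cartesianProduct []      M t = refl
  ∑-cartesianProduct (i ∷ L) M t = trans (∑-++ (map (i ,_) M) _ t)
    (+-cong (∑-map (i ,_) M t) (∑-cartesianProduct L M t))

  ⟦⟧-yes : ∀ {p} {P : Set p} (P? : Dec P) → P → ⟦ P? ⟧ ≈ 1#
  ⟦⟧-yes (yes _) p = refl
  ⟦⟧-yes (no ¬p) p = contradiction p ¬p

  ⟦⟧-⇔ : ∀ {p q} {P : Set p} {Q : Set q} (P? : Dec P) (Q? : Dec Q) → (P → Q) → (Q → P) → ⟦ P? ⟧ ≈ ⟦ Q? ⟧
  ⟦⟧-⇔ (yes p) Q? f g = sym (⟦⟧-yes Q? (f p))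
  ⟦⟧-⇔ (no ¬p) Q? f g = sym (⟦⟧-no Q? (¬p ∘ g))

  ∑-upTo-suc : ∀ n (t : ℕ → Carrier) → ∑ (upTo (suc n)) t ≈ t 0 + ∑ (upTo n) (t ∘ suc)
  ∑-upTo-suc n t = +-congˡ (trans
    (reflexive (≡.cong (λ L → ∑ L t) (≡.sym (List.map-upTo suc n)))) (∑-map suc (upTo n) t))

  opaque
    -- Sums over the diagonal i + j = n. Both indices are arguments of the summand, which keeps
    -- truncated subtraction out of the commutation and reassociation below.
    ∑ᵈ : ℕ → (ℕ → ℕ → Carrier) → Carrier
    ∑ᵈ n t = ∑ (upTo (suc n)) (λ i → t i (n ∸ i))

    ∑ᵈ-cong : ∀ n {t u : ℕ → ℕ → Carrier} → (∀ i j → t i j ≈ u i j) → ∑ᵈ n t ≈ ∑ᵈ n u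
    ∑ᵈ-cong n p = ∑-cong (upTo (suc n)) (λ i → p i (n ∸ i))

    ∑ᵈ-+ : ∀ n t u → ∑ᵈ n (λ i j → t i j + u i j) ≈ ∑ᵈ n t + ∑ᵈ n u
    ∑ᵈ-+ n t u = ∑-+ (upTo (suc n)) (λ i → t i (n ∸ i)) (λ i → u i (n ∸ i))

    ∑ᵈ-∑ : ∀ {i} {I : Set i} n (L : List I) (t : I → ℕ → ℕ → Carrier) →
           ∑ L (λ x → ∑ᵈ n (t x)) ≈ ∑ᵈ n (λ i j → ∑ L (λ x → t x i j))
    ∑ᵈ-∑ n L t = ∑-swap L (upTo (suc n)) (λ x i → t x i (n ∸ i))

    ∑ᵈ-zero : ∀ t → ∑ᵈ 0 t ≈ t 0 0
    ∑ᵈ-zero t = +-identityʳ _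

    ∑ᵈ-first : ∀ n t → ∑ᵈ (suc n) t ≈ t 0 (suc n) + ∑ᵈ n (λ i j → t (suc i) j)
    ∑ᵈ-first n t = ∑-upTo-suc (suc n) (λ i → t i (suc n ∸ i))

    ∑ᵈ-upTo : ∀ n t → ∑ᵈ n t ≈ t 0 n + ∑ (upTo n) (λ i → t (suc i) (n ∸ suc i))
    ∑ᵈ-upTo n t = ∑-upTo-suc n (λ i → t i (n ∸ i))

    ∑ᵈ-splits : ∀ n a φ → ∑ (splits (n ∷ a)) φ ≈ ∑ᵈ n (λ i j → ∑ (splits a) (λ (b , c) → φ (i ∷ b , j ∷ c)))
    ∑ᵈ-splits n a φ = ∑-splits n a φ

  ∑ᵈ-last : ∀ n t → ∑ᵈ (suc n) t ≈ ∑ᵈ n (λ i j → t i (suc j)) + t (suc n) 0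
  ∑ᵈ-last zero    t = trans (∑ᵈ-first 0 t) (+-cong (sym (∑ᵈ-zero (λ i j → t i (suc j)))) (∑ᵈ-zero (λ i j → t (suc i) j)))
  ∑ᵈ-last (suc n) t = begin
    ∑ᵈ (suc (suc n)) t
      ≈⟨ ∑ᵈ-first (suc n) t ⟩
    t 0 (suc (suc n)) + ∑ᵈ (suc n) (λ i j → t (suc i) j)
      ≈⟨ +-congˡ (∑ᵈ-last n (λ i j → t (suc i) j)) ⟩
    t 0 (suc (suc n)) + (∑ᵈ n (λ i j → t (suc i) (suc j)) + t (suc (suc n)) 0)
      ≈⟨ +-assoc _ _ _ ⟨
    t 0 (suc (suc n)) + ∑ᵈ n (λ i j → t (suc i) (suc j)) + t (suc (suc n)) 0
      ≈⟨ +-congʳ (∑ᵈ-first n (λ i j → t i (suc j))) ⟨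
    ∑ᵈ (suc n) (λ i j → t i (suc j)) + t (suc (suc n)) 0 ∎

  -- Splitting off the first term on one side and the last on the other leaves two diagonals that
  -- are mirror images, to which induction applies.
  ∑ᵈ-comm : ∀ n t → ∑ᵈ n t ≈ ∑ᵈ n (λ i j → t j i)
  ∑ᵈ-comm zero    t = trans (∑ᵈ-zero t) (sym (∑ᵈ-zero (λ i j → t j i)))
  ∑ᵈ-comm (suc n) t = begin
    ∑ᵈ (suc n) t                                     ≈⟨ ∑ᵈ-first n t ⟩
    t 0 (suc n) + ∑ᵈ n (λ i j → t (suc i) j)         ≈⟨ +-congˡ (∑ᵈ-comm n (λ i j → t (suc i) j)) ⟩
    t 0 (suc n) + ∑ᵈ n (λ i j → t (suc j) i)         ≈⟨ +-comm _ _ ⟩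
    ∑ᵈ n (λ i j → t (suc j) i) + t 0 (suc n)         ≈⟨ ∑ᵈ-last n (λ i j → t j i) ⟨
    ∑ᵈ (suc n) (λ i j → t j i)                       ∎

  -- Both sides run over the triples j + m + l = n. After the terms with j = 0 are split off, the
  -- rest is the claim for the predecessor with the first index shifted.
  ∑ᵈ-assoc : ∀ n (t : ℕ → ℕ → ℕ → Carrier) →
             ∑ᵈ n (λ i l → ∑ᵈ i (λ j m → t j m l)) ≈ ∑ᵈ n (λ j r → ∑ᵈ r (λ m l → t j m l))
  ∑ᵈ-assoc zero    t = trans (trans (∑ᵈ-zero _) (∑ᵈ-zero _))
    (sym (trans (∑ᵈ-zero (λ j r → ∑ᵈ r (t j))) (∑ᵈ-zero (t 0))))
  ∑ᵈ-assoc (suc n) t = begin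
    ∑ᵈ (suc n) (λ i l → ∑ᵈ i (λ j m → t j m l))
      ≈⟨ ∑ᵈ-first n _ ⟩
    ∑ᵈ 0 (λ j m → t j m (suc n)) + ∑ᵈ n (λ i l → ∑ᵈ (suc i) (λ j m → t j m l))
      ≈⟨ +-cong (∑ᵈ-zero _) (trans (∑ᵈ-cong n (λ i l → ∑ᵈ-first i (λ j m → t j m l))) (∑ᵈ-+ n _ _)) ⟩
    t 0 0 (suc n) + (∑ᵈ n (λ i l → t 0 (suc i) l) + ∑ᵈ n (λ i l → ∑ᵈ i (λ j m → t (suc j) m l)))
      ≈⟨ +-assoc _ _ _ ⟨
    t 0 0 (suc n) + ∑ᵈ n (λ i l → t 0 (suc i) l) + ∑ᵈ n (λ i l → ∑ᵈ i (λ j m → t (suc j) m l))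
      ≈⟨ +-cong (sym (∑ᵈ-first n (t 0))) (∑ᵈ-assoc n (λ j → t (suc j))) ⟩
    ∑ᵈ (suc n) (t 0) + ∑ᵈ n (λ j r → ∑ᵈ r (t (suc j)))
      ≈⟨ ∑ᵈ-first n _ ⟨
    ∑ᵈ (suc n) (λ j r → ∑ᵈ r (t j)) ∎

  ∑ˢ : List ℕ → (List ℕ → List ℕ → Carrier) → Carrier
  ∑ˢ a φ = ∑ (splits a) (uncurry φ)

  ∑ˢ-cong : ∀ a {φ ψ : List ℕ → List ℕ → Carrier} → (∀ b c → φ b c ≈ ψ b c) → ∑ˢ a φ ≈ ∑ˢ a ψ
  ∑ˢ-cong a p = ∑-cong (splits a) (λ (b , c) → p b c)

  ∑ˢ-∷ : ∀ n a φ → ∑ˢ (n ∷ a) φ ≈ ∑ᵈ n (λ i j → ∑ˢ a (λ b c → φ (i ∷ b) (j ∷ c)))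
  ∑ˢ-∷ n a φ = ∑ᵈ-splits n a (uncurry φ)

  ∑ˢ-comm : ∀ a φ → ∑ˢ a φ ≈ ∑ˢ a (λ b c → φ c b)
  ∑ˢ-comm []      φ = refl
  ∑ˢ-comm (n ∷ a) φ = begin
    ∑ˢ (n ∷ a) φ                                          ≈⟨ ∑ˢ-∷ n a φ ⟩
    ∑ᵈ n (λ i j → ∑ˢ a (λ b c → φ (i ∷ b) (j ∷ c)))       ≈⟨ ∑ᵈ-comm n _ ⟩
    ∑ᵈ n (λ i j → ∑ˢ a (λ b c → φ (j ∷ b) (i ∷ c)))       ≈⟨ ∑ᵈ-cong n (λ i j → ∑ˢ-comm a _) ⟩
    ∑ᵈ n (λ i j → ∑ˢ a (λ b c → φ (j ∷ c) (i ∷ b)))       ≈⟨ ∑ˢ-∷ n a (λ b c → φ c b) ⟨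
    ∑ˢ (n ∷ a) (λ b c → φ c b)                            ∎

  ∑ˢ-assoc : ∀ a (φ : List ℕ → List ℕ → List ℕ → Carrier) →
             ∑ˢ a (λ r d → ∑ˢ r (λ b c → φ b c d)) ≈ ∑ˢ a (λ b r → ∑ˢ r (λ c d → φ b c d))
  ∑ˢ-assoc []      φ = refl
  ∑ˢ-assoc (n ∷ a) φ = begin
    ∑ˢ (n ∷ a) (λ r d → ∑ˢ r (λ b c → φ b c d))
      ≈⟨ ∑ˢ-∷ n a _ ⟩
    ∑ᵈ n (λ i l → ∑ˢ a (λ r d → ∑ˢ (i ∷ r) (λ b c → φ b c (l ∷ d))))
      ≈⟨ ∑ᵈ-cong n (λ i l → trans (∑ˢ-cong a (λ r d → ∑ˢ-∷ i r _)) (∑ᵈ-∑ i (splits a) _)) ⟩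
    ∑ᵈ n (λ i l → ∑ᵈ i (λ j m → ∑ˢ a (λ r d → ∑ˢ r (λ b c → φ (j ∷ b) (m ∷ c) (l ∷ d)))))
      ≈⟨ ∑ᵈ-assoc n _ ⟩
    ∑ᵈ n (λ j r → ∑ᵈ r (λ m l → ∑ˢ a (λ r d → ∑ˢ r (λ b c → φ (j ∷ b) (m ∷ c) (l ∷ d)))))
      ≈⟨ ∑ᵈ-cong n (λ j r → ∑ᵈ-cong r (λ m l → ∑ˢ-assoc a _)) ⟩
    ∑ᵈ n (λ j r → ∑ᵈ r (λ m l → ∑ˢ a (λ b r → ∑ˢ r (λ c d → φ (j ∷ b) (m ∷ c) (l ∷ d)))))
      ≈⟨ ∑ᵈ-cong n (λ j i → trans (∑ˢ-cong a (λ b r → ∑ˢ-∷ i r _)) (∑ᵈ-∑ i (splits a) _)) ⟨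
    ∑ᵈ n (λ j i → ∑ˢ a (λ b r → ∑ˢ (i ∷ r) (λ c d → φ (j ∷ b) c d)))
      ≈⟨ ∑ˢ-∷ n a _ ⟨
    ∑ˢ (n ∷ a) (λ b r → ∑ˢ r (λ c d → φ b c d)) ∎

  -- A factorisation of x^a y^b is an independent choice of factorisations of x^a and y^b. This is
  -- the source of the multiplicativity of the coproduct.
  ∑ˢ-++ : ∀ a {b} φ → ∑ˢ (a ++ b) φ ≈ ∑ˢ a (λ a₁ a₂ → ∑ˢ b (λ b₁ b₂ → φ (a₁ ++ b₁) (a₂ ++ b₂)))
  ∑ˢ-++ []          φ = sym (+-identityʳ _)
  ∑ˢ-++ (n ∷ a) {b} φ = trans (∑ˢ-∷ n (a ++ b) φ)
    (trans (∑ᵈ-cong n (λ i j → ∑ˢ-++ a _)) (sym (∑ˢ-∷ n a _)))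

  infixl 7 _∗_
  _∗_ : Series → Series → Series
  _∗_ = convolve

  *-∑ˢ : ∀ x a φ → x * ∑ˢ a φ ≈ ∑ˢ a (λ b c → x * φ b c)
  *-∑ˢ x a φ = *-∑ x (splits a) (uncurry φ)

  ∑ˢ-* : ∀ a φ x → ∑ˢ a φ * x ≈ ∑ˢ a (λ b c → φ b c * x)
  ∑ˢ-* a φ x = ∑-* (splits a) (uncurry φ) x

  ∗-cong : ∀ {f f′ g g′ : Series} → (∀ a → f a ≈ f′ a) → (∀ a → g a ≈ g′ a) → ∀ a → (f ∗ g) a ≈ (f′ ∗ g′) a
  ∗-cong p q a = ∑ˢ-cong a (λ b c → *-cong (p b) (q c))

  ∗-comm : ∀ f g a → (f ∗ g) a ≈ (g ∗ f) a
  ∗-comm f g a = trans (∑ˢ-comm a (λ b c → f b * g c)) (∑ˢ-cong a (λ b c → *-comm _ _))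

  ∗-assoc : ∀ f g h a → (f ∗ g ∗ h) a ≈ (f ∗ (g ∗ h)) a
  ∗-assoc f g h a = begin
    ∑ˢ a (λ r d → ∑ˢ r (λ b c → f b * g c) * h d)     ≈⟨ ∑ˢ-cong a (λ r d → ∑ˢ-* r _ _) ⟩
    ∑ˢ a (λ r d → ∑ˢ r (λ b c → f b * g c * h d))     ≈⟨ ∑ˢ-assoc a (λ b c d → f b * g c * h d) ⟩
    ∑ˢ a (λ b r → ∑ˢ r (λ c d → f b * g c * h d))     ≈⟨ ∑ˢ-cong a (λ b r → trans (*-∑ˢ _ r _)
                                                           (∑ˢ-cong r (λ c d → sym (*-assoc _ _ _)))) ⟨
    ∑ˢ a (λ b r → f b * ∑ˢ r (λ c d → g c * h d))     ∎

  ∗-leftComm : ∀ f g h a → (f ∗ (g ∗ h)) a ≈ (g ∗ (f ∗ h)) a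
  ∗-leftComm f g h a = begin
    (f ∗ (g ∗ h)) a   ≈⟨ ∗-assoc f g h a ⟨
    (f ∗ g ∗ h) a     ≈⟨ ∗-cong (∗-comm f g) (λ _ → refl) a ⟩
    (g ∗ f ∗ h) a     ≈⟨ ∗-assoc g f h a ⟩
    (g ∗ (f ∗ h)) a   ∎

  ∗-∑ : ∀ {i} {I : Set i} f (L : List I) (t : I → Series) a →
        (f ∗ (λ b → ∑ L (λ i → t i b))) a ≈ ∑ L (λ i → (f ∗ t i) a)
  ∗-∑ f L t a = trans (∑ˢ-cong a (λ b c → *-∑ (f b) L (λ i → t i c))) (∑-swap (splits a) L _)

  ∗-* : ∀ f x g a → (f ∗ (λ b → x * g b)) a ≈ x * (f ∗ g) a
  ∗-* f x g a = trans (∑ˢ-cong a (λ b c → trans (sym (*-assoc _ _ _))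
    (trans (*-congʳ (*-comm _ _)) (*-assoc _ _ _)))) (sym (*-∑ˢ x a _))

  ∗-identityˡ : ∀ g a → (coeff 1Λ ∗ g) a ≈ g a
  ∗-identityˡ g []      = trans (+-identityʳ _) (*-identityˡ _)
  ∗-identityˡ g (n ∷ a) = begin
    (coeff 1Λ ∗ g) (n ∷ a)
      ≈⟨ ∑ˢ-∷ n a _ ⟩
    ∑ᵈ n (λ i j → ∑ˢ a (λ b c → ⟦ i ℕ.+ sum b ℕ.≟ 0 ⟧ * g (j ∷ c)))
      ≈⟨ ∑ᵈ-upTo n _ ⟩
    (coeff 1Λ ∗ (λ c → g (n ∷ c))) a + ∑ (upTo n) (λ i → ∑ˢ a (λ b c → 0# * g (n ∸ suc i ∷ c)))
      ≈⟨ +-cong (∗-identityˡ (λ c → g (n ∷ c)) a) (∑-zero (upTo n) (λ i → ∑-zero (splits a) (λ _ → zeroˡ _))) ⟩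
    g (n ∷ a) + 0#
      ≈⟨ +-identityʳ _ ⟩
    g (n ∷ a) ∎

  ∗-identityʳ : ∀ g a → (g ∗ coeff 1Λ) a ≈ g a
  ∗-identityʳ g a = trans (∗-comm g (coeff 1Λ) a) (∗-identityˡ g a)

-- Partitions: canonical forms of exponent lists and finite enumerations

isPartition-irrelevant : ∀ {a} (p q : IsPartition a) → p ≡ q
isPartition-irrelevant (mkIsPartition d p) (mkIsPartition d′ p′) =
  ≡.cong₂ mkIsPartition (Linked.irrelevant ℕ.≤-irrelevant d d′) (All.irrelevant ℕ.≤-irrelevant p p′)

parts-injective : ∀ {ν μ} → parts ν ≡ parts μ → ν ≡ μ
parts-injective {mkPartition a p} {mkPartition .a q} ≡.refl = ≡.cong (mkPartition a) (isPartition-irrelevant p q)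

bparts-injective : ∀ {k} {α β : BoundedPartition k} → bparts α ≡ bparts β → α ≡ β
bparts-injective {k} {mkBounded ν p} {mkBounded μ q} e with ≡.refl ← parts-injective {ν} {μ} e =
  ≡.cong (mkBounded ν) (ℕ.≤-irrelevant p q)

infix 4 _≟ᴾ_ _≟ᴮ_

_≟ᴾ_ : DecidableEquality Partition
ν ≟ᴾ μ with List.≡-dec ℕ._≟_ (parts ν) (parts μ)
... | yes e = yes (parts-injective e)
... | no ne = no (λ e → ne (≡.cong parts e))

_≟ᴮ_ : ∀ {k} → DecidableEquality (BoundedPartition k)
α ≟ᴮ β with List.≡-dec ℕ._≟_ (bparts α) (bparts β)
... | yes e = yes (bparts-injective e)
... | no ne = no (λ e → ne (≡.cong bparts e))

opaque
  -- The representative of the orbit of a monomial. The sort is decreasing, as partitions require,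
  -- while `IsRearrangementOf?` sorts increasingly; the two are reconciled through permutations.
  canon : List ℕ → Partition
  canon a = mkPartition (Decreasing.sort (support a)) (mkIsPartition (Decreasing.sort-↗ (support a))
    (All-resp-↭ (↭-sym (Decreasing.sort-↭ (support a))) (All.all-filter (0 ℕ.<?_) a)))

  canon-↭ : ∀ a → parts (canon a) ↭ support a
  canon-↭ a = Decreasing.sort-↭ (support a)

sum-canon : ∀ a → sum (parts (canon a)) ≡ sum a
sum-canon a = ≡.trans (sum-↭ (canon-↭ a)) (sum-support a)

decreasing-unique : ∀ {a b} → Linked _≥_ a → Linked _≥_ b → a ↭ b → a ≡ b
decreasing-unique d d′ p = Pointwise-≡⇒≡ (↗↭↗⇒≋ (Flip.totalOrder ℕ.≤-totalOrder) d d′ (↭⇒↭ₛ p))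

support-parts : ∀ ν → support (parts ν) ≡ parts ν
support-parts ν = List.filter-all (0 ℕ.<?_) (IsPartition.positive (isPartition ν))

↭-canon : ∀ a ν → support a ↭ parts ν → canon a ≡ ν
↭-canon a ν p = parts-injective (decreasing-unique (IsPartition.decreasing (isPartition (canon a)))
  (IsPartition.decreasing (isPartition ν)) (↭-trans (canon-↭ a) p))

canon-parts : ∀ ν → canon (parts ν) ≡ ν
canon-parts ν = ↭-canon (parts ν) ν (↭-reflexive (support-parts ν))

canon⇒rearrangement : ∀ a {ν} → canon a ≡ ν → Increasing.sort (support a) ≡ Increasing.sort (support (parts ν))
canon⇒rearrangement a ≡.refl =
  sort-cong (↭-trans (↭-sym (canon-↭ a)) (↭-reflexive (≡.sym (support-parts (canon a)))))

rearrangement⇒canon : ∀ a {ν} → Increasing.sort (support a) ≡ Increasing.sort (support (parts ν)) → canon a ≡ ν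
rearrangement⇒canon a {ν} e = ↭-canon a ν (↭-trans (↭-sym (Increasing.sort-↭ (support a)))
  (↭-trans (↭-reflexive e) (↭-trans (Increasing.sort-↭ _) (↭-reflexive (support-parts ν)))))

words : ℕ → ℕ → List (List ℕ)
words zero    n = [ [] ]
words (suc l) n = [] ∷ concatMap (λ i → map (i ∷_) (words l n)) (upTo (suc n))

-- Positive entries make the length at most the sum. The bounds are separate because `l` drops along
-- the recursion while the range `n` of the entries stays fixed.
∈-words : ∀ {l n a} → All (0 <_) a → sum a ≤ l → l ≤ n → a ∈ words l n
∈-words {zero}  []        _   _   = here ≡.refl
∈-words {suc l} []        _   _   = here ≡.refl
∈-words {zero}  (s≤s _ ∷ _) () _
∈-words {suc l} {n} {x ∷ a} (s≤s _ ∷ 0<a) x+a≤1+l 1+l≤n = there (∈-concatMap⁺ (λ i → map (i ∷_) (words l n))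
  (Any.map (λ { ≡.refl → ∈-map⁺ (x ∷_) (∈-words 0<a (ℕ.≤-trans (ℕ.m≤n+m (sum a) _) (ℕ.≤-pred x+a≤1+l))
                                         (ℕ.≤-trans (ℕ.n≤1+n l) 1+l≤n)) })
    (∈-upTo⁺ (s≤s (ℕ.≤-trans (ℕ.m≤m+n x (sum a)) (ℕ.≤-trans x+a≤1+l 1+l≤n))))))

opaque
  -- Besides all partitions of size at most n, some larger ones
  partitions : ℕ → List Partition
  partitions n = deduplicate _≟ᴾ_ (map canon (words n n))

  partitions-unique : ∀ n → Unique (partitions n)
  partitions-unique n = deduplicate-! _≟ᴾ_ (map canon (words n n))

  ∈-partitions : ∀ {n} ν → sum (parts ν) ≤ n → ν ∈ partitions n
  ∈-partitions {n} ν p = ∈-deduplicate⁺ _≟ᴾ_ (≡.subst (_∈ map canon (words n n)) (canon-parts ν)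
    (∈-map⁺ canon (∈-words (IsPartition.positive (isPartition ν)) p ℕ.≤-refl)))

canon-∈-partitions : ∀ {n} a → sum a ≤ n → canon a ∈ partitions n
canon-∈-partitions {n} a p = ∈-partitions (canon a) (≡.subst (_≤ n) (≡.sym (sum-canon a)) p)

part₀-bounds : ∀ {k a} → Linked _≥_ a → part a 0 ≤ k → All (_≤ k) a
part₀-bounds []       p = []
part₀-bounds [-]      p = p ∷ []
part₀-bounds (q ∷ qs) p = p ∷ part₀-bounds qs (ℕ.≤-trans q p)

bounds-part₀ : ∀ {k a} → All (_≤ k) a → part a 0 ≤ k
bounds-part₀ []      = z≤n
bounds-part₀ (p ∷ _) = p

module _ {k : ℕ} where

  Bounded : List ℕ → Set
  Bounded = All (_≤ k)

  bounded? : ∀ a → Dec (Bounded a)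
  bounded? = All.all? (ℕ._≤? k)

  support-bounded⁻ : ∀ a → Bounded (support a) → Bounded a
  support-bounded⁻ []          _       = []
  support-bounded⁻ (zero ∷ a)  p       = z≤n ∷ support-bounded⁻ a p
  support-bounded⁻ (suc n ∷ a) (p ∷ q) = p ∷ support-bounded⁻ a q

  canon-bounded : ∀ a → Bounded a → part (parts (canon a)) 0 ≤ k
  canon-bounded a p = bounds-part₀ (All-resp-↭ (↭-sym (canon-↭ a)) (All.filter⁺ (0 ℕ.<?_) p))

  canon-bounded⁻ : ∀ a → part (parts (canon a)) 0 ≤ k → Bounded a
  canon-bounded⁻ a p = support-bounded⁻ a (All-resp-↭ (canon-↭ a)
    (part₀-bounds (IsPartition.decreasing (isPartition (canon a))) p))

  boundedOnly : List Partition → List (BoundedPartition k)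
  boundedOnly []      = []
  boundedOnly (ν ∷ L) with part (parts ν) 0 ℕ.≤? k
  ... | yes p = mkBounded ν p ∷ boundedOnly L
  ... | no _  = boundedOnly L

  ∈-boundedOnly : ∀ {L} (β : BoundedPartition k) → partition β ∈ L → β ∈ boundedOnly L
  ∈-boundedOnly {ν ∷ L} β q with part (parts ν) 0 ℕ.≤? k | q
  ... | yes _ | here e    = here (bparts-injective (≡.cong parts e))
  ... | yes _ | there q′  = there (∈-boundedOnly β q′)
  ... | no ¬p | here e    = contradiction (≡.subst (λ ν → part (parts ν) 0 ≤ k) e (bounded β)) ¬p
  ... | no _  | there q′  = ∈-boundedOnly β q′

  size : BoundedPartition k → ℕ
  size β = sum (bparts β)

  opaque
    boundedPartitions : ℕ → List (BoundedPartition k)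
    boundedPartitions n = deduplicate _≟ᴮ_ (boundedOnly (partitions n))

    boundedPartitions-unique : ∀ n → Unique (boundedPartitions n)
    boundedPartitions-unique n = deduplicate-! _≟ᴮ_ (boundedOnly (partitions n))

    ∈-boundedPartitions : ∀ {n} β → size β ≤ n → β ∈ boundedPartitions n
    ∈-boundedPartitions β p = ∈-deduplicate⁺ _≟ᴮ_ (∈-boundedOnly β (∈-partitions (partition β) p))

  ∉-boundedPartitions : ∀ {n} β → β ∉ boundedPartitions n → n < size β
  ∉-boundedPartitions β p = ℕ.≰⇒> (p ∘ ∈-boundedPartitions β)

unboundedPartitions : ℕ → ℕ → List Partition
unboundedPartitions k n = filter (λ ν → k ℕ.<? part (parts ν) 0) (partitions n)

-- Symmetric functions: monomial expansion, coproduct of the h_b, and the ideal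

module SymmetricAlgebra {c ℓ} (F : CommutativeRing c ℓ) where

  open CommutativeRing F hiding (zero)
  open SymmetricFunctions F
  open Convolution F
  open import Relation.Binary.Reasoning.Setoid setoid
  open import Algebra.Properties.CommutativeSemigroup *-commutativeSemigroup
    using () renaming (interchange to *-interchange)
  open import Algebra.Properties.Ring ring using (-1*x≈-x)

  coeff-∑Λ : ∀ {i} {I : Set i} (L : List I) t a → coeff (∑Λ L t) a ≈ ∑ L (λ i → coeff (t i) a)
  coeff-∑Λ []      t a = refl
  coeff-∑Λ (i ∷ L) t a = +-congˡ (coeff-∑Λ L t a)

  coeff-∑₂ : ∀ {i} {I : Set i} (L : List I) t a b → ∑₂ L t a b ≈ ∑ L (λ i → t i a b)
  coeff-∑₂ []      t a b = refl
  coeff-∑₂ (i ∷ L) t a b = +-congˡ (coeff-∑₂ L t a b)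

  -- The coefficient of x^a in f[X+Z], as a function of Z
  shift : List ℕ → Λ → Λ
  shift a f = record
    { coeff     = λ z → coeff f (a ++ z)
    ; symmetric = λ p → symmetric f (++⁺ˡ a p)
    ; stable    = λ z → trans (reflexive (≡.cong (coeff f) (≡.sym (List.++-assoc a z (0 ∷ []))))) (stable f (a ++ z))
    ; degree    = degree f
    ; vanishes  = λ z p → vanishes f (a ++ z) (ℕ.<-≤-trans p (ℕ.≤-trans (ℕ.m≤n+m (sum z) (sum a))
                    (ℕ.≤-reflexive (≡.sym (sum-++ a z)))))
    }

  coeff-0∷ : ∀ f a → coeff f (0 ∷ a) ≈ coeff f a
  coeff-0∷ f a = trans (symmetric f (∷↭∷ʳ 0 a)) (stable f a)

  coeff-support : ∀ f a → coeff f a ≈ coeff f (support a)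
  coeff-support f []          = refl
  coeff-support f (zero ∷ a)  = trans (coeff-0∷ f a) (coeff-support f a)
  coeff-support f (suc n ∷ a) = coeff-support (shift (suc n ∷ []) f) a

  coeff-canon : ∀ f a → coeff f a ≈ coeff f (parts (canon a))
  coeff-canon f a = trans (coeff-support f a) (symmetric f (↭-sym (canon-↭ a)))

  coeff-m : ∀ ν a → coeff (m ν) a ≈ ⟦ canon a ≟ᴾ ν ⟧
  coeff-m ν a = ⟦⟧-⇔ (a IsRearrangementOf? parts ν) (canon a ≟ᴾ ν) (rearrangement⇒canon a) (canon⇒rearrangement a)

  coeff-m-canon : ∀ a → coeff (m (canon a)) a ≈ 1#
  coeff-m-canon a = trans (coeff-m (canon a) a) (⟦⟧-yes (canon a ≟ᴾ canon a) ≡.refl)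

  coeff-m-≢ : ∀ {ν} a → ν ≢ canon a → coeff (m ν) a ≈ 0#
  coeff-m-≢ {ν} a ne = trans (coeff-m ν a) (⟦⟧-no (canon a ≟ᴾ ν) (ne ∘ ≡.sym))

  m-expand-∈ : ∀ (t : Partition → Carrier) {L} a → Unique L → canon a ∈ L →
               ∑ L (λ ν → t ν * coeff (m ν) a) ≈ t (canon a)
  m-expand-∈ t {L} a !L p = begin
    ∑ L (λ ν → t ν * coeff (m ν) a)
      ≈⟨ ∑-single !L p (λ ν ne → trans (*-congˡ (coeff-m-≢ a ne)) (zeroʳ _)) ⟩
    t (canon a) * coeff (m (canon a)) a
      ≈⟨ trans (*-congˡ (coeff-m-canon a)) (*-identityʳ _) ⟩
    t (canon a) ∎

  m-expand-∉ : ∀ (t : Partition → Carrier) {L} a → canon a ∉ L → ∑ L (λ ν → t ν * coeff (m ν) a) ≈ 0#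
  m-expand-∉ t {L} a p = ∑-none p (λ ν ne → trans (*-congˡ (coeff-m-≢ a ne)) (zeroʳ _))

  -- Only `ν = canon a` contributes at `a`. If it is missing from the list, then `a` exceeds the
  -- degree of `f` and both sides vanish. The slack in `N` lets several functions share one list.
  m-expansion : ∀ f {N} → degree f ≤ N → ∀ a →
                coeff f a ≈ ∑ (partitions N) (λ ν → coeff f (parts ν) * coeff (m ν) a)
  m-expansion f {N} d≤N a with DecMembership._∈?_ _≟ᴾ_ (canon a) (partitions N)
  ... | yes p = trans (coeff-canon f a) (sym (m-expand-∈ (λ ν → coeff f (parts ν)) a (partitions-unique N) p))
  ... | no ¬p = trans (vanishes f a (ℕ.≤-<-trans d≤N (ℕ.≰⇒> (¬p ∘ canon-∈-partitions a))))
                      (sym (m-expand-∉ (λ ν → coeff f (parts ν)) a ¬p))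

  hˡ : List ℕ → Λ
  hˡ = foldr (λ n f → h n *Λ f) 1Λ

  h-homogeneous : ∀ n a → sum a ≢ n → coeff (h n) a ≈ 0#
  h-homogeneous n a = ⟦⟧-no (sum a ℕ.≟ n)

  hˡ-homogeneous : ∀ b a → sum a ≢ sum b → coeff (hˡ b) a ≈ 0#
  hˡ-homogeneous []      a ne = h-homogeneous 0 a ne
  hˡ-homogeneous (n ∷ b) a ne = ∑-splits-deg a (λ a₁ a₂ → coeff (h n) a₁ * coeff (hˡ b) a₂) vanish
    where
    vanish : ∀ a₁ a₂ → sum a₁ ℕ.+ sum a₂ ≡ sum a → coeff (h n) a₁ * coeff (hˡ b) a₂ ≈ 0#
    vanish a₁ a₂ e with sum a₁ ℕ.≟ n
    ... | no ne₁     = trans (*-congʳ (h-homogeneous n a₁ ne₁)) (zeroˡ _)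
    ... | yes ≡.refl = trans (*-congˡ (hˡ-homogeneous b a₂
                         (λ e₂ → ne (≡.trans (≡.sym e) (≡.cong (sum a₁ ℕ.+_) e₂))))) (zeroʳ _)

  hˡ-0∷ : ∀ b → hˡ (0 ∷ b) ≈Λ hˡ b
  hˡ-0∷ b = ∗-identityˡ (coeff (hˡ b))

  hˡ-++ : ∀ b c → hˡ (b ++ c) ≈Λ hˡ b *Λ hˡ c
  hˡ-++ []      c a = sym (∗-identityˡ _ a)
  hˡ-++ (n ∷ b) c a = trans (∗-cong (λ _ → refl) (hˡ-++ b c) a) (sym (∗-assoc (coeff (h n)) _ _ a))

  hˡ-↭ : ∀ {b c} → b ↭ c → hˡ b ≈Λ hˡ c
  hˡ-↭ _↭_.refl                a = refl
  hˡ-↭ (prep n p)              a = ∗-cong (λ _ → refl) (hˡ-↭ p) a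
  hˡ-↭ (swap {ys = c} n n′ p)  a = trans (∗-leftComm (coeff (h n)) (coeff (h n′)) _ a)
    (∗-cong (λ _ → refl) (∗-cong (λ _ → refl) (hˡ-↭ p)) a)
  hˡ-↭ (_↭_.trans p q)         a = trans (hˡ-↭ p a) (hˡ-↭ q a)

  hˡ-support : ∀ b → hˡ b ≈Λ hˡ (support b)
  hˡ-support []          a = refl
  hˡ-support (zero ∷ b)  a = trans (hˡ-0∷ b a) (hˡ-support b a)
  hˡ-support (suc n ∷ b) a = ∗-cong (λ _ → refl) (hˡ-support b) a

  hˡ-canon : ∀ b → hˡ b ≈Λ hᵖ (canon b)
  hˡ-canon b a = trans (hˡ-support b a) (hˡ-↭ (↭-sym (canon-↭ b)) a)

  Δ-* : ∀ f g a b → Δ (f *Λ g) a b ≈ (Δ f ⋆ Δ g) a b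
  Δ-* f g a b = ∑ˢ-++ a (λ c d → coeff f c * coeff g d)

  ⋆-cong : ∀ {T T′ U U′ : Series₂} → T ≈₂ T′ → U ≈₂ U′ → T ⋆ U ≈₂ T′ ⋆ U′
  ⋆-cong p q a b = ∑ˢ-cong a (λ a₁ a₂ → ∑ˢ-cong b (λ b₁ b₂ → *-cong (p a₁ b₁) (q a₂ b₂)))

  ⋆-⊗ : ∀ {i j} {I : Set i} {J : Set j} (L : List I) (M : List J)
        (f g : I → Series) (f′ g′ : J → Series) a b →
        ((λ a b → ∑ L (λ i → f i a * g i b)) ⋆ (λ a b → ∑ M (λ j → f′ j a * g′ j b))) a b ≈
        ∑ L (λ i → ∑ M (λ j → (f i ∗ f′ j) a * (g i ∗ g′ j) b))
  ⋆-⊗ L M f g f′ g′ a b = begin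
    ∑ˢ a (λ a₁ a₂ → ∑ˢ b (λ b₁ b₂ → ∑ L (λ i → f i a₁ * g i b₁) * ∑ M (λ j → f′ j a₂ * g′ j b₂)))
      ≈⟨ ∑ˢ-cong a (λ a₁ a₂ → ∑ˢ-cong b (λ b₁ b₂ → ∑-*-∑ L M _ _)) ⟩
    ∑ˢ a (λ a₁ a₂ → ∑ˢ b (λ b₁ b₂ → ∑ L (λ i → ∑ M (λ j → f i a₁ * g i b₁ * (f′ j a₂ * g′ j b₂)))))
      ≈⟨ ∑ˢ-cong a (λ a₁ a₂ → trans (∑-swap (splits b) L _) (∑-cong L (λ i → ∑-swap (splits b) M _))) ⟩
    ∑ˢ a (λ a₁ a₂ → ∑ L (λ i → ∑ M (λ j → ∑ˢ b (λ b₁ b₂ → f i a₁ * g i b₁ * (f′ j a₂ * g′ j b₂)))))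
      ≈⟨ trans (∑-swap (splits a) L _) (∑-cong L (λ i → ∑-swap (splits a) M _)) ⟩
    ∑ L (λ i → ∑ M (λ j → ∑ˢ a (λ a₁ a₂ → ∑ˢ b (λ b₁ b₂ → f i a₁ * g i b₁ * (f′ j a₂ * g′ j b₂)))))
      ≈⟨ ∑-cong L (λ i → ∑-cong M (λ j → ∑ˢ-cong a (λ a₁ a₂ → ∑ˢ-cong b (λ b₁ b₂ → *-interchange _ _ _ _)))) ⟩
    ∑ L (λ i → ∑ M (λ j → ∑ˢ a (λ a₁ a₂ → ∑ˢ b (λ b₁ b₂ → f i a₁ * f′ j a₂ * (g i b₁ * g′ j b₂)))))
      ≈⟨ ∑-cong L (λ i → ∑-cong M (λ j → ∑-*-∑ (splits a) (splits b) _ _)) ⟨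
    ∑ L (λ i → ∑ M (λ j → (f i ∗ f′ j) a * (g i ∗ g′ j) b)) ∎

  -- The only index that survives is `i = sum a`, which is in range exactly when `sum a ≤ n`;
  -- otherwise both sides are zero.
  Δ-h : ∀ n a b → Δ (h n) a b ≈ ∑ (upTo (suc n)) (λ i → coeff (h i) a * coeff (h (n ∸ i)) b)
  Δ-h n a b with sum a ℕ.≤? n
  ... | yes p = begin
    ⟦ sum (a ++ b) ℕ.≟ n ⟧
      ≈⟨ ⟦⟧-⇔ (sum (a ++ b) ℕ.≟ n) (sum b ℕ.≟ (n ∸ sum a))
           (λ e → ≡.trans (≡.sym (ℕ.m+n∸m≡n (sum a) (sum b))) (≡.cong (_∸ sum a) (≡.trans (≡.sym (sum-++ a b)) e)))
           (λ e → ≡.trans (sum-++ a b) (≡.trans (≡.cong (sum a ℕ.+_) e) (ℕ.m+[n∸m]≡n p))) ⟩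
    ⟦ sum b ℕ.≟ (n ∸ sum a) ⟧
      ≈⟨ trans (*-congʳ (⟦⟧-yes (sum a ℕ.≟ sum a) ≡.refl)) (*-identityˡ _) ⟨
    ⟦ sum a ℕ.≟ sum a ⟧ * ⟦ sum b ℕ.≟ (n ∸ sum a) ⟧
      ≈⟨ ∑-single (upTo⁺ (suc n)) (∈-upTo⁺ (s≤s p)) (λ i ne →
           trans (*-congʳ (h-homogeneous i a (ne ∘ ≡.sym))) (zeroˡ _)) ⟨
    ∑ (upTo (suc n)) (λ i → coeff (h i) a * coeff (h (n ∸ i)) b) ∎
  ... | no ¬p = trans
    (h-homogeneous n (a ++ b) (λ e → ¬p (≡.subst (sum a ≤_) (≡.trans (≡.sym (sum-++ a b)) e) (ℕ.m≤m+n (sum a) (sum b)))))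
    (sym (∑-upTo-0 (suc n) _ (λ i i<1+n → trans
      (*-congʳ (h-homogeneous i a (λ e → ¬p (≡.subst (_≤ n) (≡.sym e) (ℕ.≤-pred i<1+n))))) (zeroˡ _))))

  -- As `h 0` is the unit, zero exponents are allowed, and the coproduct of h_c runs over the same
  -- `splits c` that define products of series in Y. The h_c are thus a coalgebra dual to
  -- multiplication of monomials.
  Δ-hˡ : ∀ c a b → Δ (hˡ c) a b ≈ ∑ˢ c (λ c₁ c₂ → coeff (hˡ c₁) a * coeff (hˡ c₂) b)
  Δ-hˡ []      a b = trans (Δ-h 0 a b) refl
  Δ-hˡ (n ∷ c) a b = begin
    Δ (h n *Λ hˡ c) a b
      ≈⟨ Δ-* (h n) (hˡ c) a b ⟩
    (Δ (h n) ⋆ Δ (hˡ c)) a b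
      ≈⟨ ⋆-cong (Δ-h n) (Δ-hˡ c) a b ⟩
    ((λ a b → ∑ (upTo (suc n)) (λ i → coeff (h i) a * coeff (h (n ∸ i)) b)) ⋆
     (λ a b → ∑ (splits c) (λ (c₁ , c₂) → coeff (hˡ c₁) a * coeff (hˡ c₂) b))) a b
      ≈⟨ ⋆-⊗ (upTo (suc n)) (splits c) (λ i → coeff (h i)) (λ i → coeff (h (n ∸ i)))
             (λ (c₁ , c₂) → coeff (hˡ c₁)) (λ (c₁ , c₂) → coeff (hˡ c₂)) a b ⟩
    ∑ (upTo (suc n)) (λ i → ∑ (splits c) (λ (c₁ , c₂) → coeff (hˡ (i ∷ c₁)) a * coeff (hˡ ((n ∸ i) ∷ c₂)) b))
      ≈⟨ ∑-splits n c _ ⟨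
    ∑ˢ (n ∷ c) (λ c₁ c₂ → coeff (hˡ c₁) a * coeff (hˡ c₂) b) ∎

  -Λ_ : Λ → Λ
  -Λ f = (- 1#) · f

  module _ (k : ℕ) where

    m-vanishes : ∀ {ν} → k < part (parts ν) 0 → ∀ a → Bounded {k} a → coeff (m ν) a ≈ 0#
    m-vanishes {ν} k<ν a p = coeff-m-≢ {ν} a (λ { ≡.refl → ℕ.<⇒≱ k<ν (canon-bounded a p) })

    -- At a bounded monomial, a product with `m ν` sees `m ν` at bounded monomials only, where it is
    -- zero if ν₁ > k.
    ideal-vanishes : ∀ {f} → Ideal k f → ∀ a → Bounded {k} a → coeff f a ≈ 0#
    ideal-vanishes null           a p = refl
    ideal-vanishes (gen f ν k<ν)  a p = trans (∑-congᴬ (All.map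
      (λ {(b , c)} (_ , q) → trans (*-congˡ (m-vanishes {ν} k<ν c q)) (zeroʳ _)) (splits-≤ a p))) (∑-0 (splits a))
    ideal-vanishes (plus i j)     a p = trans (+-cong (ideal-vanishes i a p) (ideal-vanishes j a p)) (+-identityˡ _)
    ideal-vanishes (resp e i)     a p = trans (sym (e a)) (ideal-vanishes i a p)

    -- The scalar enters through the multiplier `x · 1Λ` of the generator.
    m-ideal : ∀ x {ν} → k < part (parts ν) 0 → Ideal k (x · m ν)
    m-ideal x {ν} k<ν = resp (λ a → begin
      (coeff (x · 1Λ) ∗ coeff (m ν)) a     ≈⟨ ∗-comm _ _ a ⟩
      (coeff (m ν) ∗ coeff (x · 1Λ)) a     ≈⟨ ∗-* (coeff (m ν)) x (coeff 1Λ) a ⟩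
      x * (coeff (m ν) ∗ coeff 1Λ) a       ≈⟨ *-congˡ (∗-identityʳ _ a) ⟩
      x * coeff (m ν) a                    ∎) (gen (x · 1Λ) ν k<ν)

    ∑Λ-ideal : ∀ {i} {I : Set i} {L : List I} {t} → All (Ideal k ∘ t) L → Ideal k (∑Λ L t)
    ∑Λ-ideal []       = null
    ∑Λ-ideal (p ∷ ps) = plus p (∑Λ-ideal ps)

    unbounded-large : ∀ n → All (λ ν → k < part (parts ν) 0) (unboundedPartitions k n)
    unbounded-large n = All.all-filter _ (partitions n)

    -- Together with `unbounded-expansion-0`: a finite sum of the t_ν m_ν over unbounded ν can
    -- prescribe values at unbounded exponents of size at most `n` without touching the bounded
    -- ones.
    unbounded-expansion : ∀ (t : Partition → Carrier) {n} a → ¬ Bounded {k} a → sum a ≤ n →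
                          ∑ (unboundedPartitions k n) (λ ν → t ν * coeff (m ν) a) ≈ t (canon a)
    unbounded-expansion t {n} a ¬p a≤n = m-expand-∈ t a (unique-filter⁺ _ (partitions-unique n))
      (∈-filter⁺ _ (canon-∈-partitions a a≤n) (ℕ.≰⇒> (¬p ∘ canon-bounded⁻ a)))

    unbounded-expansion-0 : ∀ (t : Partition → Carrier) {n} a → Bounded {k} a →
                            ∑ (unboundedPartitions k n) (λ ν → t ν * coeff (m ν) a) ≈ 0#
    unbounded-expansion-0 t {n} a p = trans (∑-congᴬ (All.map
      (λ {ν} k<ν → trans (*-congˡ (m-vanishes {ν} k<ν a p)) (zeroʳ _)) (unbounded-large n))) (∑-0 (unboundedPartitions k n))

    -- Converse of `ideal-vanishes`. In the monomial expansion of `f`, the terms with ν₁ ≤ k have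
    -- coefficient zero by hypothesis, and the others lie in the ideal.
    vanishes-ideal : ∀ f → (∀ a → Bounded {k} a → coeff f a ≈ 0#) → Ideal k f
    vanishes-ideal f f0 = resp (λ a → trans (coeff-∑Λ (partitions N) (λ ν → coeff f (parts ν) · m ν) a) (sym (m-expansion f ℕ.≤-refl a)))
      (∑Λ-ideal {t = λ ν → coeff f (parts ν) · m ν} (All.tabulate {xs = partitions N} (λ {ν} _ → term ν)))
      where
      N = degree f
      term : ∀ ν → Ideal k (coeff f (parts ν) · m ν)
      term ν with k ℕ.<? part (parts ν) 0
      ... | yes k<ν = m-ideal (coeff f (parts ν)) {ν} k<ν
      ... | no  k≮ν = resp (λ a → sym (trans (*-congʳ (f0 (parts ν) (part₀-bounds
              (IsPartition.decreasing (isPartition ν)) (ℕ.≮⇒≥ k≮ν)))) (zeroˡ _))) null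

    ≈ᵏ⇒≈ : ∀ f g → _≈ᵏ_ k f g → ∀ a → Bounded {k} a → coeff f a ≈ coeff g a
    ≈ᵏ⇒≈ f g (i , ideal , e) a p = trans (e a) (trans (+-congˡ (ideal-vanishes ideal a p)) (+-identityʳ _))

    ≈⇒≈ᵏ : ∀ f g → (∀ a → Bounded {k} a → coeff f a ≈ coeff g a) → _≈ᵏ_ k f g
    ≈⇒≈ᵏ f g e = f +Λ (-Λ g)
      , vanishes-ideal (f +Λ (-Λ g)) (λ a p → trans (+-cong (e a p) (-1*x≈-x _)) (-‿inverseʳ _))
      , (λ a → sym (begin
          coeff g a + (coeff f a + (- 1#) * coeff g a)    ≈⟨ +-congˡ (+-comm _ _) ⟩
          coeff g a + ((- 1#) * coeff g a + coeff f a)    ≈⟨ +-assoc _ _ _ ⟨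
          coeff g a + (- 1#) * coeff g a + coeff f a      ≈⟨ +-congʳ (trans (+-congˡ (-1*x≈-x _)) (-‿inverseʳ _)) ⟩
          0# + coeff f a                                  ≈⟨ +-identityˡ _ ⟩
          coeff f a ∎))

    ≈ᵏᵏ⇒≈ : ∀ {T U} → _≈ᵏᵏ_ k T U → ∀ a b → Bounded {k} a → Bounded {k} b → T a b ≈ U a b
    ≈ᵏᵏ⇒≈ {T} {U} (L , ideals , e) a b p q = trans (e a b) (trans (+-congˡ (trans (coeff-∑₂ L _ a b)
      (trans (∑-congᴬ (All.map vanish ideals)) (∑-0 L)))) (+-identityʳ _))
      where
      vanish : ∀ {fg} → Ideal k (proj₁ fg) ⊎ Ideal k (proj₂ fg) → coeff (proj₁ fg) a * coeff (proj₂ fg) b ≈ 0#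
      vanish (inj₁ i) = trans (*-congʳ (ideal-vanishes i a p)) (zeroˡ _)
      vanish (inj₂ i) = trans (*-congˡ (ideal-vanishes i b q)) (zeroʳ _)

-- Finite tensors, equality in the quotients, and linear spans

module Tensors {c ℓ} (F : CommutativeRing c ℓ) (k : ℕ) where

  open CommutativeRing F hiding (zero)
  open SymmetricFunctions F
  open Convolution F
  open SymmetricAlgebra F
  open import Relation.Binary.Reasoning.Setoid setoid
  open import Algebra.Properties.Ring ring using (-1*x≈-x)

  ∑Λ-degree : ∀ {i} {I : Set i} (L : List I) t → All (λ i → degree (t i) ≤ degree (∑Λ L t)) L
  ∑Λ-degree []      t = []
  ∑Λ-degree (i ∷ L) t = ℕ.m≤m⊔n _ _ ∷ All.map (λ p → ℕ.≤-trans p (ℕ.m≤n⊔m _ _)) (∑Λ-degree L t)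

  ⟪_⟫ : List (Λ × Λ) → Series₂
  ⟪ D ⟫ a b = ∑ D (λ (f , g) → coeff f a * coeff g b)

  coeff-⟪⟫ : ∀ D → ∑₂ D (uncurry _⊗_) ≈₂ ⟪ D ⟫
  coeff-⟪⟫ D = coeff-∑₂ D (uncurry _⊗_)

  negate : List (Λ × Λ) → List (Λ × Λ)
  negate = map (λ (f , g) → -Λ f , g)

  ⟪negate⟫ : ∀ D a b → ⟪ negate D ⟫ a b ≈ - ⟪ D ⟫ a b
  ⟪negate⟫ D a b = begin
    ⟪ negate D ⟫ a b
      ≈⟨ ∑-map _ D _ ⟩
    ∑ D (λ (f , g) → - 1# * coeff f a * coeff g b)
      ≈⟨ ∑-cong D (λ _ → *-assoc _ _ _) ⟩
    ∑ D (λ (f , g) → - 1# * (coeff f a * coeff g b))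
      ≈⟨ *-∑ (- 1#) D _ ⟨
    - 1# * ⟪ D ⟫ a b
      ≈⟨ -1*x≈-x _ ⟩
    - ⟪ D ⟫ a b ∎

  -- T lies in I ⊗ Λ + Λ ⊗ I as soon as its bounded coefficients vanish: expand
  -- the first factors in the basis m ν, and collect the second factors.
  vanishes-tensor : ∀ D → (∀ a b → Bounded {k} a → Bounded {k} b → ⟪ D ⟫ a b ≈ 0#) →
                    ∃ λ L → All (λ (f , g) → Ideal k f ⊎ Ideal k g) L × ⟪ D ⟫ ≈₂ ⟪ L ⟫
  vanishes-tensor D D0 = map (λ ν → m ν , row ν) (partitions N)
    , All.map⁺ (All.tabulate {xs = partitions N} (λ {ν} _ → ideal ν))
    , (λ a b → begin
        ⟪ D ⟫ a b
          ≈⟨ ∑-congᴬ (All.map (λ {fg} p → *-congʳ (m-expansion (proj₁ fg) p a)) (∑Λ-degree D proj₁)) ⟩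
        ∑ D (λ (f , g) → ∑ (partitions N) (λ ν → coeff f (parts ν) * coeff (m ν) a) * coeff g b)
          ≈⟨ ∑-cong D (λ (f , g) → trans (∑-* (partitions N) _ _) (∑-cong (partitions N) (λ ν →
               trans (*-congʳ (*-comm _ _)) (*-assoc _ _ _)))) ⟩
        ∑ D (λ (f , g) → ∑ (partitions N) (λ ν → coeff (m ν) a * (coeff f (parts ν) * coeff g b)))
          ≈⟨ ∑-swap D (partitions N) _ ⟩
        ∑ (partitions N) (λ ν → ∑ D (λ (f , g) → coeff (m ν) a * (coeff f (parts ν) * coeff g b)))
          ≈⟨ ∑-cong (partitions N) (λ ν → trans (sym (*-∑ _ D _)) (*-congˡ (sym (coeff-row ν b)))) ⟩
        ∑ (partitions N) (λ ν → coeff (m ν) a * coeff (row ν) b)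
          ≈⟨ ∑-map (λ ν → m ν , row ν) (partitions N) _ ⟨
        ⟪ map (λ ν → m ν , row ν) (partitions N) ⟫ a b ∎)
    where
    -- The degree bound carried by a sum is the maximum of those of its terms, so one `N` serves all
    -- first factors.
    N = degree (∑Λ D proj₁)
    row : Partition → Λ
    row ν = ∑Λ D (λ (f , g) → coeff f (parts ν) · g)
    coeff-row : ∀ ν b → coeff (row ν) b ≈ ⟪ D ⟫ (parts ν) b
    coeff-row ν b = coeff-∑Λ D (λ (f , g) → coeff f (parts ν) · g) b
    ideal : ∀ ν → Ideal k (m ν) ⊎ Ideal k (row ν)
    ideal ν with k ℕ.<? part (parts ν) 0
    ... | yes k<ν = inj₁ (resp (λ a → *-identityˡ _) (m-ideal k 1# {ν} k<ν))
    ... | no  k≮ν = inj₂ (vanishes-ideal k (row ν) (λ b p → trans (coeff-row ν b) (D0 (parts ν) b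
            (part₀-bounds (IsPartition.decreasing (isPartition ν)) (ℕ.≮⇒≥ k≮ν)) p)))

  -- The expansion of f[X+Y] in monomial functions of X; the coefficient of `m ν` is the coefficient
  -- of x^ν, a symmetric function of Y. Since `shift b f` keeps the degree bound of `f`, one list of
  -- partitions works for all `b`.
  Δ-tensor : ∀ f → ∃ λ D → Δ f ≈₂ ⟪ D ⟫
  Δ-tensor f = map (λ ν → m ν , shift (parts ν) f) P , (λ a b → begin
    coeff f (a ++ b)
      ≈⟨ symmetric f (++-comm a b) ⟩
    coeff (shift b f) a
      ≈⟨ m-expansion (shift b f) ℕ.≤-refl a ⟩
    ∑ P (λ ν → coeff f (b ++ parts ν) * coeff (m ν) a)
      ≈⟨ ∑-cong P (λ ν → trans (*-comm _ _) (*-congˡ (symmetric f (++-comm b (parts ν))))) ⟩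
    ∑ P (λ ν → coeff (m ν) a * coeff f (parts ν ++ b))
      ≈⟨ ∑-map (λ ν → m ν , shift (parts ν) f) P _ ⟨
    ⟪ map (λ ν → m ν , shift (parts ν) f) P ⟫ a b ∎)
    where P = partitions (degree f)

  x+y-y : ∀ x y → y + (x + - y) ≈ x
  x+y-y x y = begin
    y + (x + - y)   ≈⟨ +-congˡ (+-comm x (- y)) ⟩
    y + (- y + x)   ≈⟨ +-assoc _ _ _ ⟨
    y + - y + x     ≈⟨ +-congʳ (-‿inverseʳ y) ⟩
    0# + x          ≈⟨ +-identityˡ x ⟩
    x               ∎

  -- The antipode axiom asks for an equality in the tensor square of the quotient, while only
  -- bounded coefficients are known. Writing Δ f as a finite tensor first brings the difference
  -- within reach of `vanishes-tensor`.
  ≈⇒≈ᵏᵏ : ∀ f D → (∀ a b → Bounded {k} a → Bounded {k} b → Δ f a b ≈ ⟪ D ⟫ a b) →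
          _≈ᵏᵏ_ k (Δ f) (∑₂ D (uncurry _⊗_))
  ≈⇒≈ᵏᵏ f D e = L , ideals , λ a b → begin
    Δ f a b                                          ≈⟨ x+y-y _ _ ⟨
    ⟪ D ⟫ a b + (Δ f a b + - ⟪ D ⟫ a b)              ≈⟨ +-cong (sym (coeff-⟪⟫ D a b)) (sym (difference a b)) ⟩
    ∑₂ D (uncurry _⊗_) a b + ⟪ D₀ ++ negate D ⟫ a b  ≈⟨ +-congˡ (trans (D≈L a b) (sym (coeff-⟪⟫ L a b))) ⟩
    ∑₂ D (uncurry _⊗_) a b + ∑₂ L (uncurry _⊗_) a b  ∎
    where
    D₀ = proj₁ (Δ-tensor f)
    difference : ∀ a b → ⟪ D₀ ++ negate D ⟫ a b ≈ Δ f a b + - ⟪ D ⟫ a b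
    difference a b = trans (∑-++ D₀ (negate D) _) (+-cong (sym (proj₂ (Δ-tensor f) a b)) (⟪negate⟫ D a b))
    vanishing = vanishes-tensor (D₀ ++ negate D) (λ a b p q →
      trans (difference a b) (trans (+-congʳ (e a b p q)) (-‿inverseʳ _)))
    L = proj₁ vanishing
    ideals = proj₁ (proj₂ vanishing)
    D≈L = proj₂ (proj₂ vanishing)

  ∑Λ-Λ₍ₖ₎ : ∀ {i} {I : Set i} {L : List I} {t} → All (Λ₍ₖ₎ k ∘ t) L → Λ₍ₖ₎ k (∑Λ L t)
  ∑Λ-Λ₍ₖ₎ []       = resp (λ _ → zeroˡ _) (scale 0# one)
  ∑Λ-Λ₍ₖ₎ (p ∷ ps) = plus p (∑Λ-Λ₍ₖ₎ ps)

  -- In total degree `n` only finitely many orbits of unbounded y^b occur. Regrouping `D` by these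
  -- orbits gives a sum of `column ν ⊗ m ν` in Λ₍ₖ₎ ⊗ I; it agrees with `D` at unbounded `b` and
  -- vanishes at bounded `b`.
  equalInDegree : ∀ n {T U} D → All (Λ₍ₖ₎ k ∘ proj₁) D →
                  (∀ a b → sum a ℕ.+ sum b ≡ n → Bounded {k} b → T a b ≈ U a b) →
                  (∀ a b → sum a ℕ.+ sum b ≡ n → ¬ Bounded {k} b → T a b ≈ U a b + ⟪ D ⟫ a b) →
                  EqualInDegree k n T U
  equalInDegree n {T} {U} D D∈ bounded unbounded = L
    , All.map⁺ (All.map (λ {ν} k<ν → ∑Λ-Λ₍ₖ₎ (All.map (scale _) D∈)
                                   , resp (λ a → *-identityˡ _) (m-ideal k 1# {ν} k<ν)) (unbounded-large k n))
    , equal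
    where
    column : Partition → Λ
    column ν = ∑Λ D (λ (f , g) → coeff g (parts ν) · f)
    L = map (λ ν → column ν , m ν) (unboundedPartitions k n)
    coeff-L : ∀ a b → ∑₂ L (uncurry _⊗_) a b ≈ ∑ (unboundedPartitions k n) (λ ν → coeff (column ν) a * coeff (m ν) b)
    coeff-L a b = trans (coeff-⟪⟫ L a b) (∑-map (λ ν → column ν , m ν) (unboundedPartitions k n) _)
    coeff-column : ∀ a b → coeff (column (canon b)) a ≈ ⟪ D ⟫ a b
    coeff-column a b = trans (coeff-∑Λ D (λ (f , g) → coeff g (parts (canon b)) · f) a)
      (∑-cong D (λ (f , g) → trans (*-congʳ (sym (coeff-canon g b))) (*-comm _ _)))
    equal : ∀ a b → sum a ℕ.+ sum b ≡ n → T a b ≈ U a b + ∑₂ L (uncurry _⊗_) a b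
    equal a b e with bounded? b
    ... | yes p = trans (bounded a b e p) (sym (trans (+-congˡ (trans (coeff-L a b)
                    (unbounded-expansion-0 k (λ ν → coeff (column ν) a) b p))) (+-identityʳ _)))
    ... | no ¬p = trans (unbounded a b e ¬p) (+-congˡ (sym (trans (coeff-L a b) (trans
                    (unbounded-expansion k (λ ν → coeff (column ν) a) b ¬p (≡.subst (sum b ≤_) e (ℕ.m≤n+m (sum b) (sum a))))
                    (coeff-column a b)))))

  -- Inductive rather than a list of coefficients, so that linear maps are compared and transported
  -- by recursion, without a choice of coordinates.
  data Span {I : Set} (t : I → Λ) : Λ → Set (c ⊔ ℓ) where
    base  : ∀ i → Span t (t i)
    null  : Span t 0Λ
    plus  : ∀ {f g} → Span t f → Span t g → Span t (f +Λ g)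
    scale : ∀ x {f} → Span t f → Span t (x · f)
    resp  : ∀ {f g} → f ≈Λ g → Span t f → Span t g

  record Linear (φ : Λ → Carrier) : Set (c ⊔ ℓ) where
    field
      cong : ∀ {f g} → f ≈Λ g → φ f ≈ φ g
      +-hom : ∀ f g → φ (f +Λ g) ≈ φ f + φ g
      ·-hom : ∀ x f → φ (x · f) ≈ x * φ f

    0-hom : φ 0Λ ≈ 0#
    0-hom = trans (cong {0Λ} {0# · 0Λ} (λ _ → sym (zeroˡ _))) (trans (·-hom 0# 0Λ) (zeroˡ _))

    ∑-hom : ∀ {i} {I : Set i} (L : List I) t → φ (∑Λ L t) ≈ ∑ L (φ ∘ t)
    ∑-hom []      t = 0-hom
    ∑-hom (i ∷ L) t = trans (+-hom (t i) (∑Λ L t)) (+-congˡ (∑-hom L t))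

  record LinearMap (ψ : Λ → Λ) : Set (c ⊔ ℓ) where
    field
      cong : ∀ {f g} → f ≈Λ g → ψ f ≈Λ ψ g
      +-hom : ∀ f g → ψ (f +Λ g) ≈Λ ψ f +Λ ψ g
      ·-hom : ∀ x f → ψ (x · f) ≈Λ x · ψ f

  0-linear : Linear (λ _ → 0#)
  0-linear = record { cong = λ _ → refl ; +-hom = λ _ _ → sym (+-identityˡ 0#) ; ·-hom = λ x _ → sym (zeroʳ x) }

  coeff-linear : ∀ a → Linear (λ f → coeff f a)
  coeff-linear a = record { cong = λ e → e a ; +-hom = λ _ _ → refl ; ·-hom = λ _ _ → refl }

  ∘-linear : ∀ {φ ψ} → Linear φ → LinearMap ψ → Linear (φ ∘ ψ)
  ∘-linear l m = record
    { cong  = λ e → Linear.cong l (LinearMap.cong m e)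
    ; +-hom = λ f g → trans (Linear.cong l (LinearMap.+-hom m f g)) (Linear.+-hom l _ _)
    ; ·-hom = λ x f → trans (Linear.cong l (LinearMap.·-hom m x f)) (Linear.·-hom l x _)
    }

  ∑-linear : ∀ {I : Set} (L : List I) {φ : I → Λ → Carrier} → (∀ i → Linear (φ i)) → (x : I → Carrier) →
             Linear (λ f → ∑ L (λ i → φ i f * x i))
  ∑-linear L l x = record
    { cong  = λ e → ∑-cong L (λ i → *-congʳ (Linear.cong (l i) e))
    ; +-hom = λ f g → trans (∑-cong L (λ i → trans (*-congʳ (Linear.+-hom (l i) f g)) (distribʳ _ _ _))) (∑-+ L _ _)
    ; ·-hom = λ y f → trans (∑-cong L (λ i → trans (*-congʳ (Linear.·-hom (l i) y f)) (*-assoc _ _ _))) (sym (*-∑ y L _))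
    }

  id-linear : LinearMap id
  id-linear = record { cong = id ; +-hom = λ _ _ _ → refl ; ·-hom = λ _ _ _ → refl }

  shift-linear : ∀ a → LinearMap (shift a)
  shift-linear a = record { cong = λ e b → e (a ++ b) ; +-hom = λ _ _ _ → refl ; ·-hom = λ _ _ _ → refl }

  *ˡ-linear : ∀ f → LinearMap (f *Λ_)
  *ˡ-linear f = record
    { cong  = λ e → ∗-cong {coeff f} (λ _ → refl) e
    ; +-hom = λ g g′ a → trans (∑-cong (splits a) (λ _ → distribˡ _ _ _)) (∑-+ (splits a) _ _)
    ; ·-hom = λ x g → ∗-* (coeff f) x (coeff g)
    }

  *ʳ-linear : ∀ g → LinearMap (_*Λ g)
  *ʳ-linear g = record
    { cong  = λ e → ∗-cong e (λ _ → refl)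
    ; +-hom = λ f f′ a → trans (∑-cong (splits a) (λ _ → distribʳ _ _ _)) (∑-+ (splits a) _ _)
    ; ·-hom = λ x f a → trans (∑-cong (splits a) (λ _ → *-assoc _ _ _)) (sym (*-∑ x (splits a) _))
    }

  span-ext : ∀ {I : Set} {t : I → Λ} {φ ψ} → Linear φ → Linear ψ → (∀ i → φ (t i) ≈ ψ (t i)) →
             ∀ {f} → Span t f → φ f ≈ ψ f
  span-ext l m p (base i)    = p i
  span-ext l m p null        = trans (Linear.0-hom l) (sym (Linear.0-hom m))
  span-ext l m p (plus q r)  = trans (Linear.+-hom l _ _)
    (trans (+-cong (span-ext l m p q) (span-ext l m p r)) (sym (Linear.+-hom m _ _)))
  span-ext l m p (scale x q) = trans (Linear.·-hom l x _) (trans (*-congˡ (span-ext l m p q)) (sym (Linear.·-hom m x _)))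
  span-ext l m p (resp e q)  = trans (sym (Linear.cong l e)) (trans (span-ext l m p q) (Linear.cong m e))

  span-map : ∀ {I J : Set} {t : I → Λ} {u : J → Λ} {ψ} → LinearMap ψ → (∀ i → Span u (ψ (t i))) →
             ∀ {f} → Span t f → Span u (ψ f)
  span-map m p (base i)    = p i
  span-map {ψ = ψ} m p null = resp (λ a → sym (trans (LinearMap.cong m {0Λ} {0# · 0Λ} (λ _ → sym (zeroˡ _)) a)
    (trans (LinearMap.·-hom m 0# 0Λ a) (zeroˡ _)))) null
  span-map m p (plus q r)  = resp (λ a → sym (LinearMap.+-hom m _ _ a)) (plus (span-map m p q) (span-map m p r))
  span-map m p (scale x q) = resp (λ a → sym (LinearMap.·-hom m x _ a)) (scale x (span-map m p q))
  span-map m p (resp e q)  = resp (LinearMap.cong m e) (span-map m p q)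

  span-∑ : ∀ {i} {I : Set i} {J : Set} {u : J → Λ} {L : List I} {t} → All (Span u ∘ t) L → Span u (∑Λ L t)
  span-∑ []       = null
  span-∑ (p ∷ ps) = plus p (span-∑ ps)

  -- `P` restricts the degree: `_≡ d` for homogeneous elements, `_≢ d` for the other components,
  -- `_≤ d` for a filtration. Any bounded list may serve as `b`, so products need no sorting.
  HSpan : (ℕ → Set) → Λ → Set (c ⊔ ℓ)
  HSpan P = Span {∃ λ b → Bounded {k} b × P (sum b)} (hˡ ∘ proj₁)

  HSpan-mono : ∀ {P Q : ℕ → Set} → (∀ {d} → P d → Q d) → ∀ {f} → HSpan P f → HSpan Q f
  HSpan-mono P⊆Q = span-map id-linear (λ (b , b≤k , p) → base (b , b≤k , P⊆Q p))

  Λ₍ₖ₎⇒HSpan : ∀ {f} → Λ₍ₖ₎ k f → HSpan (λ _ → ⊤) f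
  Λ₍ₖ₎⇒HSpan (gen r _ r≤k) = resp (∗-identityʳ (coeff (h r))) (base ([ r ] , r≤k ∷ [] , tt))
  Λ₍ₖ₎⇒HSpan one           = base ([] , [] , tt)
  Λ₍ₖ₎⇒HSpan (scale x p)   = scale x (Λ₍ₖ₎⇒HSpan p)
  Λ₍ₖ₎⇒HSpan (plus p q)    = plus (Λ₍ₖ₎⇒HSpan p) (Λ₍ₖ₎⇒HSpan q)
  Λ₍ₖ₎⇒HSpan (times {g = g} p q) = span-map (*ʳ-linear g) (λ (b , b≤k , _) → span-map (*ˡ-linear (hˡ b))
    (λ (c , c≤k , _) → resp (hˡ-++ b c) (base (b ++ c , All.++⁺ b≤k c≤k , tt))) (Λ₍ₖ₎⇒HSpan q)) (Λ₍ₖ₎⇒HSpan p)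
  Λ₍ₖ₎⇒HSpan (resp e p)    = resp e (Λ₍ₖ₎⇒HSpan p)

  HSpan-split : ∀ d {f} → HSpan (λ _ → ⊤) f →
                ∃ λ g → ∃ λ g′ → HSpan (_≡ d) g × HSpan (_≢ d) g′ × f ≈Λ g +Λ g′
  HSpan-split d (base (b , b≤k , _)) with sum b ℕ.≟ d
  ... | yes e = hˡ b , 0Λ , base (b , b≤k , e) , null , (λ _ → sym (+-identityʳ _))
  ... | no ne = 0Λ , hˡ b , null , base (b , b≤k , ne) , (λ _ → sym (+-identityˡ _))
  HSpan-split d null = 0Λ , 0Λ , null , null , (λ _ → sym (+-identityˡ _))
  HSpan-split d (plus p q) with HSpan-split d p | HSpan-split d q
  ... | g , g′ , p₁ , p₂ , e | f , f′ , q₁ , q₂ , e′ =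
    g +Λ f , g′ +Λ f′ , plus p₁ q₁ , plus p₂ q₂ , (λ a → trans (+-cong (e a) (e′ a)) (interchange _ _ _ _))
    where open import Algebra.Properties.CommutativeSemigroup +-commutativeSemigroup using (interchange)
  HSpan-split d (scale x p) with HSpan-split d p
  ... | g , g′ , p₁ , p₂ , e = x · g , x · g′ , scale x p₁ , scale x p₂ , (λ a → trans (*-congˡ (e a)) (distribˡ _ _ _))
  HSpan-split d (resp e p) with HSpan-split d p
  ... | g , g′ , p₁ , p₂ , e′ = g , g′ , p₁ , p₂ , (λ a → trans (sym (e a)) (e′ a))

  -- Λ₍ₖ₎ is a subcoalgebra: by `Δ-hˡ` the coefficient of x^a in h_b[X+Z] is a combination of the
  -- h_{b₂}[Z] with y^{b₂} a factor of y^b, hence bounded and no larger.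
  HSpan-shift : ∀ {d} a {f} → HSpan (_≤ d) f → HSpan (_≤ d) (shift a f)
  HSpan-shift {d} a = span-map (shift-linear a) (λ (b , b≤k , b≤d) →
    resp (λ z → trans (coeff-∑Λ (splits b) (λ (b₁ , b₂) → coeff (hˡ b₁) a · hˡ b₂) z) (sym (Δ-hˡ b a z)))
      (span-∑ (All.map (λ {(b₁ , b₂)} ((_ , b₂≤k) , e) → scale (coeff (hˡ b₁) a) (base (b₂ , b₂≤k
        , ℕ.≤-trans (ℕ.m≤n+m (sum b₂) (sum b₁)) (≡.subst (_≤ d) (≡.sym e) b≤d))))
        (All.zip (splits-≤ b b≤k , splits-sum b)))))

  HSpan-homogeneous : ∀ {d f} → HSpan (_≡ d) f → ∀ a → sum a ≢ d → coeff f a ≈ 0#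
  HSpan-homogeneous p a ne = span-ext (coeff-linear a) 0-linear
    (λ (b , _ , e) → hˡ-homogeneous b a (λ e′ → ne (≡.trans e′ e))) p

-- The Hall pairing as extraction of coefficients

module Pairing {c ℓ} (F : CommutativeRing c ℓ) (k : ℕ)
  (⟨_,_⟩ : SymmetricFunctions.Λ F → SymmetricFunctions.Λ F → CommutativeRing.Carrier F)
  (hall : SymmetricFunctions.IsHallPairing F ⟨_,_⟩) where

  open CommutativeRing F hiding (zero)
  open SymmetricFunctions F
  open Convolution F
  open SymmetricAlgebra F
  open Tensors F k
  open import Relation.Binary.Reasoning.Setoid setoid
  module Hall = IsHallPairing hall

  pair-linearˡ : ∀ g → Linear (λ f → ⟨ f , g ⟩)
  pair-linearˡ g = record
    { cong  = λ {f} {f′} e → Hall.cong {f} {f′} {g} {g} e (λ _ → refl)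
    ; +-hom = λ f f′ → Hall.+ˡ f f′ g
    ; ·-hom = λ x f → Hall.·ˡ x f g
    }

  pair-linearʳ : ∀ f → Linear (λ g → ⟨ f , g ⟩)
  pair-linearʳ f = record
    { cong  = λ {g} {g′} e → Hall.cong {f} {f} {g} {g′} (λ _ → refl) e
    ; +-hom = Hall.+ʳ f
    ; ·-hom = λ x g → Hall.·ʳ x f g
    }

  pair-hˡ : ∀ b g → ⟨ hˡ b , g ⟩ ≈ coeff g b
  pair-hˡ b g = begin
    ⟨ hˡ b , g ⟩
      ≈⟨ Hall.cong (hˡ-canon b) (λ a → trans (m-expansion g (ℕ.m≤m⊔n (degree g) (sum b)) a)
           (sym (coeff-∑Λ P (λ ν → coeff g (parts ν) · m ν) a))) ⟩
    ⟨ hᵖ (canon b) , ∑Λ P (λ ν → coeff g (parts ν) · m ν) ⟩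
      ≈⟨ Linear.∑-hom (pair-linearʳ (hᵖ (canon b))) P _ ⟩
    ∑ P (λ ν → ⟨ hᵖ (canon b) , coeff g (parts ν) · m ν ⟩)
      ≈⟨ ∑-cong P (λ ν → trans (Hall.·ʳ _ _ _) (*-congˡ (Hall.dual (canon b) ν))) ⟩
    ∑ P (λ ν → coeff g (parts ν) * ⟦ List.≡-dec ℕ._≟_ (parts (canon b)) (parts ν) ⟧)
      ≈⟨ ∑-single (partitions-unique N) (canon-∈-partitions b (ℕ.m≤n⊔m (degree g) (sum b))) (λ ν ne →
           trans (*-congˡ (⟦⟧-no (List.≡-dec ℕ._≟_ (parts (canon b)) (parts ν)) (ne ∘ ≡.sym ∘ parts-injective))) (zeroʳ _)) ⟩
    coeff g (parts (canon b)) * ⟦ List.≡-dec ℕ._≟_ (parts (canon b)) (parts (canon b)) ⟧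
      ≈⟨ trans (*-congˡ (⟦⟧-yes (List.≡-dec ℕ._≟_ (parts (canon b)) (parts (canon b))) ≡.refl)) (*-identityʳ _) ⟩
    coeff g (parts (canon b))
      ≈⟨ coeff-canon g b ⟨
    coeff g b ∎
    where
    -- The maximum with `sum b` puts `canon b` in the list even when it exceeds the degree of `g`.
    N = degree g ℕ.⊔ sum b
    P = partitions N

  -- The pairing with an element of Λ₍ₖ₎ factors through the quotient Λ⁽ᵏ⁾.
  pair-cong-bounded : ∀ {P f} → HSpan P f → ∀ g g′ → (∀ b → Bounded {k} b → coeff g b ≈ coeff g′ b) →
                      ⟨ f , g ⟩ ≈ ⟨ f , g′ ⟩
  pair-cong-bounded p g g′ e = span-ext (pair-linearˡ g) (pair-linearˡ g′)
    (λ (b , b≤k , _) → trans (pair-hˡ b g) (trans (e b b≤k) (sym (pair-hˡ b g′)))) p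

  -- Multiplication by h_b is adjoint to taking the coefficient of y^b.
  pair-shift : ∀ {P f} → HSpan P f → ∀ b g → ⟨ f , shift b g ⟩ ≈ ⟨ hˡ b *Λ f , g ⟩
  pair-shift p b g = span-ext (pair-linearˡ (shift b g)) (∘-linear (pair-linearˡ g) (*ˡ-linear (hˡ b)))
    (λ (c , _) → begin
      ⟨ hˡ c , shift b g ⟩      ≈⟨ pair-hˡ c (shift b g) ⟩
      coeff g (b ++ c)          ≈⟨ pair-hˡ (b ++ c) g ⟨
      ⟨ hˡ (b ++ c) , g ⟩       ≈⟨ Linear.cong (pair-linearˡ g) (hˡ-++ b c) ⟩
      ⟨ hˡ b *Λ hˡ c , g ⟩      ∎) p

-- k-Schur functions: the grading, and skew elements as matrix coefficients

module KSchur {c ℓ} (F : CommutativeRing c ℓ) (k : ℕ)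
  (⟨_,_⟩ : SymmetricFunctions.Λ F → SymmetricFunctions.Λ F → CommutativeRing.Carrier F)
  (hall : SymmetricFunctions.IsHallPairing F ⟨_,_⟩)
  (s : BoundedPartition k → SymmetricFunctions.Λ F) (kSchur : SymmetricFunctions.IsKSchur F k s)
  (F~ : BoundedPartition k → SymmetricFunctions.Λ F)
  (dual : ∀ la mu → CommutativeRing._≈_ F ⟨ s la , F~ mu ⟩ (SymmetricFunctions.δ F la mu)) where

  open CommutativeRing F hiding (zero)
  open SymmetricFunctions F
  open Convolution F
  open SymmetricAlgebra F
  open Tensors F k
  open Pairing F k ⟨_,_⟩ hall
  open import Relation.Binary.Reasoning.Setoid setoid

  BP : Set
  BP = BoundedPartition k

  P≤ : ℕ → List BP
  P≤ = boundedPartitions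

  δ-refl : ∀ (β : BP) → δ β β ≈ 1#
  δ-refl β = ⟦⟧-yes (List.≡-dec ℕ._≟_ (bparts β) (bparts β)) ≡.refl

  δ-≢ : ∀ (β γ : BP) → β ≢ γ → δ β γ ≈ 0#
  δ-≢ β γ ne = ⟦⟧-no (List.≡-dec ℕ._≟_ (bparts β) (bparts γ)) (ne ∘ bparts-injective)

  δ-sym : ∀ (β γ : BP) → δ β γ ≈ δ γ β
  δ-sym β γ = ⟦⟧-⇔ (List.≡-dec ℕ._≟_ (bparts β) (bparts γ)) (List.≡-dec ℕ._≟_ (bparts γ) (bparts β)) ≡.sym ≡.sym

  ∑-δ : ∀ {L : List BP} {β} → Unique L → β ∈ L → (t : BP → Carrier) → ∑ L (λ γ → δ β γ * t γ) ≈ t β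
  ∑-δ {β = β} !L β∈L t = trans (∑-single !L β∈L (λ γ ne → trans (*-congʳ (δ-≢ β γ (ne ∘ ≡.sym))) (zeroˡ _)))
    (trans (*-congʳ (δ-refl β)) (*-identityˡ _))

  -- Here `P` restricts the size of the label β, not the degree of s_β; the two are identified only
  -- by `s-HSpan`.
  SSpan : (ℕ → Set) → Λ → Set (c ⊔ ℓ)
  SSpan P = Span {∃ λ (β : BP) → P (size β)} (s ∘ proj₁)

  pieri-h : ∀ r → 1 ≤ r → r ≤ k → ∀ α → SSpan (_≡ r ℕ.+ size α) (h r *Λ s α)
  pieri-h r 1≤r r≤k α with IsKSchur.pieri kSchur r 1≤r r≤k α
  ... | L , _ , L⇔ , e = resp (λ a → sym (e a)) (span-∑ (All.tabulate (λ {β} β∈L →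
    base (β , proj₁ (proj₂ (Equivalence.to (L⇔ β) β∈L))))))

  pieri-hˡ : ∀ b → Bounded {k} b → ∀ α → SSpan (_≡ sum b ℕ.+ size α) (hˡ b *Λ s α)
  pieri-hˡ []          []        α = resp (λ a → sym (∗-identityˡ _ a)) (base (α , ≡.refl))
  pieri-hˡ (zero ∷ b)  (_ ∷ b≤k) α = resp (LinearMap.cong (*ʳ-linear (s α)) {hˡ b} {hˡ (0 ∷ b)} (λ a → sym (hˡ-0∷ b a))) (pieri-hˡ b b≤k α)
  pieri-hˡ (suc r ∷ b) (p ∷ b≤k) α = resp (λ a → sym (∗-assoc (coeff (h (suc r))) _ _ a))
    (span-map (*ˡ-linear (h (suc r))) (λ (β , e) → ≡.subst (λ d → SSpan (_≡ d) (h (suc r) *Λ s β))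
      (≡.trans (≡.cong (suc r ℕ.+_) e) (≡.sym (ℕ.+-assoc (suc r) (sum b) (size α))))
      (pieri-h (suc r) (s≤s z≤n) p β)) (pieri-hˡ b b≤k α))

  -- h_b equals h_b s_∅, so iterating the Pieri rule expands it in labels of size |b|.
  HSpan⇒SSpan : ∀ P {f} → HSpan P f → SSpan P f
  HSpan⇒SSpan P = span-map id-linear (λ (b , b≤k , p) →
    span-map id-linear (λ (β , e) → base (β , ≡.subst P (≡.sym (≡.trans e (ℕ.+-identityʳ (sum b)))) p))
      (resp (λ a → trans (∗-cong (λ _ → refl) (IsKSchur.empty kSchur) a) (∗-identityʳ (coeff (hˡ b)) a)) (pieri-hˡ b b≤k ∅)))

  pair-F~-vanishes : ∀ P {f} → SSpan P f → ∀ β → ¬ P (size β) → ⟨ f , F~ β ⟩ ≈ 0#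
  pair-F~-vanishes P p β ¬Pβ = span-ext (pair-linearˡ (F~ β)) 0-linear
    (λ (γ , Pγ) → trans (dual γ β) (δ-≢ γ β (λ { ≡.refl → ¬Pβ Pγ }))) p

  -- Both sides are linear in `f` and agree at each s_γ by duality.
  s-expansion : ∀ P {f N} → SSpan P f → (∀ {d} → P d → d ≤ N) → ∀ a →
                coeff f a ≈ ∑ (P≤ N) (λ β → ⟨ f , F~ β ⟩ * coeff (s β) a)
  s-expansion P {N = N} p P≤N a = span-ext (coeff-linear a)
    (∑-linear (P≤ N) (λ β → pair-linearˡ (F~ β)) (λ β → coeff (s β) a))
    (λ (γ , Pγ) → sym (trans (∑-cong (P≤ N) (λ β → *-congʳ (dual γ β)))
      (∑-δ (boundedPartitions-unique N) (∈-boundedPartitions γ (P≤N Pγ)) (λ β → coeff (s β) a)))) p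

  -- The component g of s μ in degree |μ| is s μ itself, because by the Pieri rule
  -- the two have the same coordinates in the basis s.
  s-HSpan : ∀ μ → HSpan (_≡ size μ) (s μ)
  s-HSpan μ with HSpan-split (size μ) (Λ₍ₖ₎⇒HSpan (IsBasisOfΛ₍ₖ₎.member (IsKSchur.basis kSchur) μ))
  ... | g , g′ , p , p′ , e = resp g≈s p
    where
    coordinate : ∀ β → ⟨ g , F~ β ⟩ ≈ δ μ β
    coordinate β with size β ℕ.≟ size μ
    ... | yes q = sym (begin
      δ μ β                           ≈⟨ dual μ β ⟨
      ⟨ s μ , F~ β ⟩                  ≈⟨ Linear.cong (pair-linearˡ (F~ β)) e ⟩
      ⟨ g +Λ g′ , F~ β ⟩              ≈⟨ Linear.+-hom (pair-linearˡ (F~ β)) g g′ ⟩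
      ⟨ g , F~ β ⟩ + ⟨ g′ , F~ β ⟩    ≈⟨ +-congˡ (pair-F~-vanishes (_≢ size μ) (HSpan⇒SSpan (_≢ size μ) p′) β (λ ne → ne q)) ⟩
      ⟨ g , F~ β ⟩ + 0#               ≈⟨ +-identityʳ _ ⟩
      ⟨ g , F~ β ⟩                    ∎)
    ... | no ne = trans (pair-F~-vanishes (_≡ size μ) (HSpan⇒SSpan (_≡ size μ) p) β ne) (sym (δ-≢ μ β (λ { ≡.refl → ne ≡.refl })))
    g≈s : g ≈Λ s μ
    g≈s a = begin
      coeff g a
        ≈⟨ s-expansion (_≡ size μ) (HSpan⇒SSpan (_≡ size μ) p) ℕ.≤-reflexive a ⟩
      ∑ (P≤ (size μ)) (λ β → ⟨ g , F~ β ⟩ * coeff (s β) a)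
        ≈⟨ ∑-cong (P≤ (size μ)) (λ β → *-congʳ (coordinate β)) ⟩
      ∑ (P≤ (size μ)) (λ β → δ μ β * coeff (s β) a)
        ≈⟨ ∑-δ (boundedPartitions-unique _) (∈-boundedPartitions μ ℕ.≤-refl) (λ β → coeff (s β) a) ⟩
      coeff (s μ) a ∎

  s-homogeneous : ∀ μ a → sum a ≢ size μ → coeff (s μ) a ≈ 0#
  s-homogeneous μ = HSpan-homogeneous (s-HSpan μ)

  -- Reads one coefficient off a `FiniteSum`. For μ outside `L` the sum gives zero, and so does φ at
  -- the omitted term x_μ v_μ; but that value is x_μ, so the answer is right in this case too.
  coefficient : ∀ {φ} → Linear φ → (v : BP → Λ) → ∀ {μ} → (∀ ν → φ (v ν) ≈ δ ν μ) →
                ∀ {L} → Unique L → (x : BP → Carrier) → (μ ∉ L → φ (x μ · v μ) ≈ 0#) →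
                φ (∑Λ L (λ ν → x ν · v ν)) ≈ x μ
  coefficient {φ} l v {μ} φv {L} !L x outside = begin
    φ (∑Λ L (λ ν → x ν · v ν))     ≈⟨ Linear.∑-hom l L _ ⟩
    ∑ L (λ ν → φ (x ν · v ν))      ≈⟨ lemma (DecMembership._∈?_ _≟ᴮ_ μ L) ⟩
    φ (x μ · v μ)                  ≈⟨ term μ ⟩
    x μ * δ μ μ                    ≈⟨ *-congˡ (δ-refl μ) ⟩
    x μ * 1#                       ≈⟨ *-identityʳ _ ⟩
    x μ                            ∎
    where
    term : ∀ ν → φ (x ν · v ν) ≈ x ν * δ ν μ
    term ν = trans (Linear.·-hom l _ _) (*-congˡ (φv ν))
    others : ∀ ν → ν ≢ μ → φ (x ν · v ν) ≈ 0#
    others ν ne = trans (term ν) (trans (*-congˡ (δ-≢ ν μ ne)) (zeroʳ _))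
    lemma : Dec (μ ∈ L) → ∑ L (λ ν → φ (x ν · v ν)) ≈ φ (x μ · v μ)
    lemma (yes μ∈L) = ∑-single !L μ∈L others
    lemma (no  μ∉L) = trans (∑-none μ∉L others) (sym (outside μ∉L))

  module Skew (s/ : BP → BP → Λ) (skew : IsSkewKSchur k s s/)
              (F~/ : BP → BP → Λ) (dualSkew : IsSkewDualKSchur k F~ F~/) where

    skew-coeff : ∀ ρ μ a → coeff (s/ ρ μ) a ≈ ⟨ shift a (s ρ) , F~ μ ⟩
    skew-coeff ρ μ a with proj₂ skew ρ
    ... | L , !L , out , e = sym (begin
      ⟨ shift a (s ρ) , F~ μ ⟩
        ≈⟨ Linear.cong (pair-linearˡ (F~ μ)) (λ z → trans (e a z) (trans
             (coeff-∑₂ L (λ ν → s/ ρ ν ⊗ s ν) a z) (sym (coeff-∑Λ L (λ ν → coeff (s/ ρ ν) a · s ν) z)))) ⟩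
      ⟨ ∑Λ L (λ ν → coeff (s/ ρ ν) a · s ν) , F~ μ ⟩
        ≈⟨ coefficient (pair-linearˡ (F~ μ)) s (λ ν → dual ν μ) !L (λ ν → coeff (s/ ρ ν) a)
             (λ μ∉L → trans (Linear.cong (pair-linearˡ (F~ μ)) {g = 0Λ} (out μ μ∉L a))
               (Linear.0-hom (pair-linearˡ (F~ μ)))) ⟩
      coeff (s/ ρ μ) a ∎)

    -- The coproduct of `F~ ρ` is known only modulo the ideal in either factor. Boundedness of `b`
    -- takes care of the first factor; in the second, the pairing with `s la` from Λ₍ₖ₎ sees bounded
    -- coefficients only.
    dualSkew-coeff : ∀ ρ la b → Bounded {k} b → coeff (F~/ ρ la) b ≈ ⟨ hˡ b *Λ s la , F~ ρ ⟩
    dualSkew-coeff ρ la b b≤k with dualSkew ρ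
    ... | L , !L , out , e = sym (begin
      ⟨ hˡ b *Λ s la , F~ ρ ⟩
        ≈⟨ pair-shift {_≡ size la} (s-HSpan la) b (F~ ρ) ⟨
      ⟨ s la , shift b (F~ ρ) ⟩
        ≈⟨ pair-cong-bounded {_≡ size la} (s-HSpan la) _ (∑Λ L (λ ν → coeff (F~/ ρ ν) b · F~ ν)) (λ c c≤k →
             trans (≈ᵏᵏ⇒≈ k e b c b≤k c≤k) (trans (coeff-∑₂ L (λ ν → F~/ ρ ν ⊗ F~ ν) b c)
               (sym (coeff-∑Λ L (λ ν → coeff (F~/ ρ ν) b · F~ ν) c)))) ⟩
      ⟨ s la , ∑Λ L (λ ν → coeff (F~/ ρ ν) b · F~ ν) ⟩
        ≈⟨ coefficient (pair-linearʳ (s la)) F~ (λ ν → trans (dual la ν) (δ-sym la ν)) !L (λ ν → coeff (F~/ ρ ν) b)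
             (λ la∉L → trans (pair-cong-bounded {_≡ size la} (s-HSpan la) _ 0Λ (λ c c≤k → ≈ᵏᵏ⇒≈ k (out la la∉L) b c b≤k c≤k))
               (Linear.0-hom (pair-linearʳ (s la)))) ⟩
      coeff (F~/ ρ la) b ∎)

    -- Modulo the ideal F~_{ρ/λ} is homogeneous of degree |ρ| - |λ|, because h_b s_λ involves only
    -- labels of size |b| + |λ|.
    dualSkew-vanishes : ∀ ρ la b → Bounded {k} b → size ρ ≢ sum b ℕ.+ size la → coeff (F~/ ρ la) b ≈ 0#
    dualSkew-vanishes ρ la b b≤k ne = trans (dualSkew-coeff ρ la b b≤k) (pair-F~-vanishes (_≡ sum b ℕ.+ size la) (pieri-hˡ b b≤k la) ρ ne)

    h*s-expansion : ∀ {N} b → Bounded {k} b → ∀ la → sum b ℕ.+ size la ≤ N → ∀ a →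
                    coeff (hˡ b *Λ s la) a ≈ ∑ (P≤ N) (λ ρ → coeff (F~/ ρ la) b * coeff (s ρ) a)
    h*s-expansion {N} b b≤k la d≤N a = trans (s-expansion (_≡ sum b ℕ.+ size la) (pieri-hˡ b b≤k la) (λ e → ≡.subst (_≤ N) (≡.sym e) d≤N) a)
      (∑-cong (P≤ N) (λ ρ → *-congʳ (sym (dualSkew-coeff ρ la b b≤k))))

    Δ-s-expansion : ∀ {N} la → size la ≤ N → ∀ a z →
                    Δ (s la) a z ≈ ∑ (P≤ N) (λ η → coeff (s/ la η) a * coeff (s η) z)
    Δ-s-expansion {N} la d≤N a z = trans
      (s-expansion (_≤ N) (HSpan⇒SSpan (_≤ N) (HSpan-shift a (HSpan-mono {_≡ size la} (λ e → ≡.subst (_≤ N) (≡.sym e) d≤N) (s-HSpan la)))) id z)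
      (∑-cong (P≤ N) (λ η → *-congʳ (sym (skew-coeff la η a))))

    -- Coefficient of y^b s_μ[Z] in E[X+Z|Y] s_λ[X+Z], computed in two ways
    exchange : ∀ {M N} b → Bounded {k} b → ∀ la → sum b ℕ.+ size la ≤ N → size la ≤ M → ∀ μ a →
               ∑ (P≤ N) (λ ρ → coeff (F~/ ρ la) b * coeff (s/ ρ μ) a) ≈
               ∑ (P≤ M) (λ η → ((λ c → coeff (hˡ c *Λ s/ la η) a) ∗ coeff (F~/ μ η)) b)
    exchange {M} {N} b b≤k la d≤N d≤M μ a = begin
      ∑ (P≤ N) (λ ρ → coeff (F~/ ρ la) b * coeff (s/ ρ μ) a)
        ≈⟨ ∑-cong (P≤ N) (λ ρ → trans (*-congˡ (skew-coeff ρ μ a)) (sym (Linear.·-hom φ _ _))) ⟩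
      ∑ (P≤ N) (λ ρ → ⟨ coeff (F~/ ρ la) b · shift a (s ρ) , F~ μ ⟩)
        ≈⟨ Linear.∑-hom φ (P≤ N) (λ ρ → coeff (F~/ ρ la) b · shift a (s ρ)) ⟨
      ⟨ ∑Λ (P≤ N) (λ ρ → coeff (F~/ ρ la) b · shift a (s ρ)) , F~ μ ⟩
        ≈⟨ Linear.cong φ {g = rhs} same ⟩
      ⟨ rhs , F~ μ ⟩
        ≈⟨ Linear.∑-hom φ (splits b) (λ (b₁ , b₂) → row b₁ b₂) ⟩
      ∑ (splits b) (λ (b₁ , b₂) → ⟨ row b₁ b₂ , F~ μ ⟩)
        ≈⟨ ∑-congᴬ (All.map (λ {(b₁ , b₂)} (_ , b₂≤k) → trans (Linear.∑-hom φ (P≤ M) _) (∑-cong (P≤ M) (λ η →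
             trans (Linear.·-hom φ _ _) (*-congˡ (sym (dualSkew-coeff μ η b₂ b₂≤k)))))) (splits-≤ b b≤k)) ⟩
      ∑ (splits b) (λ (b₁ , b₂) → ∑ (P≤ M) (λ η → coeff (hˡ b₁ *Λ s/ la η) a * coeff (F~/ μ η) b₂))
        ≈⟨ ∑-swap (splits b) (P≤ M) _ ⟩
      ∑ (P≤ M) (λ η → ((λ c → coeff (hˡ c *Λ s/ la η) a) ∗ coeff (F~/ μ η)) b) ∎
      where
      φ = pair-linearˡ (F~ μ)
      row : List ℕ → List ℕ → Λ
      row b₁ b₂ = ∑Λ (P≤ M) (λ η → coeff (hˡ b₁ *Λ s/ la η) a · (hˡ b₂ *Λ s η))
      rhs : Λ
      rhs = ∑Λ (splits b) (λ (b₁ , b₂) → row b₁ b₂)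
      -- Both sides are Δ(h_b s_λ) at x^a, as functions of Z. On the left the product is expanded
      -- before the coproduct is taken; on the right the coproduct is taken factor by factor.
      same : ∑Λ (P≤ N) (λ ρ → coeff (F~/ ρ la) b · shift a (s ρ)) ≈Λ rhs
      same z = begin
        coeff (∑Λ (P≤ N) (λ ρ → coeff (F~/ ρ la) b · shift a (s ρ))) z
          ≈⟨ coeff-∑Λ (P≤ N) (λ ρ → coeff (F~/ ρ la) b · shift a (s ρ)) z ⟩
        ∑ (P≤ N) (λ ρ → coeff (F~/ ρ la) b * coeff (s ρ) (a ++ z))
          ≈⟨ h*s-expansion b b≤k la d≤N (a ++ z) ⟨
        Δ (hˡ b *Λ s la) a z
          ≈⟨ Δ-* (hˡ b) (s la) a z ⟩
        (Δ (hˡ b) ⋆ Δ (s la)) a z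
          ≈⟨ ⋆-cong (Δ-hˡ b) (Δ-s-expansion la d≤M) a z ⟩
        ((λ a z → ∑ (splits b) (λ (b₁ , b₂) → coeff (hˡ b₁) a * coeff (hˡ b₂) z)) ⋆
         (λ a z → ∑ (P≤ M) (λ η → coeff (s/ la η) a * coeff (s η) z))) a z
          ≈⟨ ⋆-⊗ (splits b) (P≤ M) (λ (b₁ , b₂) → coeff (hˡ b₁)) (λ (b₁ , b₂) → coeff (hˡ b₂))
                 (λ η → coeff (s/ la η)) (λ η → coeff (s η)) a z ⟩
        ∑ (splits b) (λ (b₁ , b₂) → ∑ (P≤ M) (λ η → coeff (hˡ b₁ *Λ s/ la η) a * coeff (hˡ b₂ *Λ s η) z))
          ≈⟨ trans (coeff-∑Λ (splits b) (λ (b₁ , b₂) → row b₁ b₂) z) (∑-cong (splits b) (λ (b₁ , b₂) →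
               coeff-∑Λ (P≤ M) (λ η → coeff (hˡ b₁ *Λ s/ la η) a · (hˡ b₂ *Λ s η)) z)) ⟨
        coeff rhs z ∎

-- Inversion by the antipode and sums in the degree completion

module Reproducing {c ℓ} (F : CommutativeRing c ℓ) (k : ℕ)
  (⟨_,_⟩ : SymmetricFunctions.Λ F → SymmetricFunctions.Λ F → CommutativeRing.Carrier F)
  (hall : SymmetricFunctions.IsHallPairing F ⟨_,_⟩)
  (S : SymmetricFunctions.Λ F → SymmetricFunctions.Λ F) (antipode : SymmetricFunctions.IsAntipode F k S)
  (s : BoundedPartition k → SymmetricFunctions.Λ F) (kSchur : SymmetricFunctions.IsKSchur F k s)
  (F~ : BoundedPartition k → SymmetricFunctions.Λ F)
  (dual : ∀ la mu → CommutativeRing._≈_ F ⟨ s la , F~ mu ⟩ (SymmetricFunctions.δ F la mu))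
  (s/ : BoundedPartition k → BoundedPartition k → SymmetricFunctions.Λ F)
  (skew : SymmetricFunctions.IsSkewKSchur F k s s/)
  (F~/ : BoundedPartition k → BoundedPartition k → SymmetricFunctions.Λ F)
  (dualSkew : SymmetricFunctions.IsSkewDualKSchur F k F~ F~/) where

  open CommutativeRing F hiding (zero)
  open SymmetricFunctions F
  open Convolution F
  open SymmetricAlgebra F
  open Tensors F k
  open Pairing F k ⟨_,_⟩ hall
  open KSchur F k ⟨_,_⟩ hall s kSchur F~ dual
  open Skew s/ skew F~/ dualSkew
  open import Relation.Binary.Reasoning.Setoid setoid

  coproduct-terms : ℕ → BP → BP → List (Λ × Λ)
  coproduct-terms N η η′ = map (λ μ → F~/ η μ , F~/ μ η′) (P≤ N)

  -- Matrix coefficients compose: h_{a++b} s_η′ = h_a (h_b s_η′). As `N` bounds only |η|, the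
  -- expansion of h_b s_η′ may exceed the cutoff; then both sides vanish for degree reasons.
  coassociative : ∀ {N} η → size η ≤ N → ∀ η′ a b → Bounded {k} a → Bounded {k} b →
                  Δ (F~/ η η′) a b ≈ ⟪ coproduct-terms N η η′ ⟫ a b
  coassociative {N} η η≤N η′ a b a≤k b≤k = trans (lemma (sum b ℕ.+ size η′ ℕ.≤? N)) (sym (∑-map _ (P≤ N) _))
    where
    φ = pair-linearˡ (F~ η)
    lemma : Dec (sum b ℕ.+ size η′ ≤ N) →
            coeff (F~/ η η′) (a ++ b) ≈ ∑ (P≤ N) (λ μ → coeff (F~/ η μ) a * coeff (F~/ μ η′) b)
    lemma (yes d≤N) = begin
      coeff (F~/ η η′) (a ++ b)
        ≈⟨ dualSkew-coeff η η′ (a ++ b) (All.++⁺ a≤k b≤k) ⟩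
      ⟨ hˡ (a ++ b) *Λ s η′ , F~ η ⟩
        ≈⟨ Linear.cong φ {hˡ (a ++ b) *Λ s η′} {hˡ a *Λ expanded} (λ z → begin
             coeff (hˡ (a ++ b) *Λ s η′) z         ≈⟨ ∗-cong (hˡ-++ a b) (λ _ → refl) z ⟩
             coeff (hˡ a *Λ hˡ b *Λ s η′) z        ≈⟨ ∗-assoc (coeff (hˡ a)) _ _ z ⟩
             coeff (hˡ a *Λ (hˡ b *Λ s η′)) z      ≈⟨ ∗-cong (λ _ → refl) (λ y → trans
               (h*s-expansion b b≤k η′ d≤N y) (sym (coeff-∑Λ (P≤ N) (λ μ → coeff (F~/ μ η′) b · s μ) y))) z ⟩
             coeff (hˡ a *Λ expanded) z            ∎) ⟩
      ⟨ hˡ a *Λ expanded , F~ η ⟩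
        ≈⟨ Linear.∑-hom (∘-linear φ (*ˡ-linear (hˡ a))) (P≤ N) _ ⟩
      ∑ (P≤ N) (λ μ → ⟨ hˡ a *Λ (coeff (F~/ μ η′) b · s μ) , F~ η ⟩)
        ≈⟨ ∑-cong (P≤ N) (λ μ → trans (Linear.·-hom (∘-linear φ (*ˡ-linear (hˡ a))) _ _)
             (trans (*-congˡ (sym (dualSkew-coeff η μ a a≤k))) (*-comm _ _))) ⟩
      ∑ (P≤ N) (λ μ → coeff (F~/ η μ) a * coeff (F~/ μ η′) b) ∎
      where
      expanded : Λ
      expanded = ∑Λ (P≤ N) (λ μ → coeff (F~/ μ η′) b · s μ)
    lemma (no d≰N) = trans
      (dualSkew-vanishes η η′ (a ++ b) (All.++⁺ a≤k b≤k) (λ e → d≰N (ℕ.≤-trans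
        (ℕ.≤-trans (ℕ.+-monoˡ-≤ (size η′) (≡.subst (sum b ≤_) (≡.sym (sum-++ a b)) (ℕ.m≤n+m (sum b) (sum a))))
          (ℕ.≤-reflexive (≡.sym e))) η≤N)))
      (sym (∑-zero (P≤ N) vanish))
      where
      vanish : ∀ μ → coeff (F~/ η μ) a * coeff (F~/ μ η′) b ≈ 0#
      vanish μ with size μ ℕ.≟ sum b ℕ.+ size η′
      ... | no ne = trans (*-congˡ (dualSkew-vanishes μ η′ b b≤k ne)) (zeroʳ _)
      ... | yes e = trans (*-congʳ (dualSkew-vanishes η μ a a≤k (λ e′ → d≰N (ℕ.≤-trans
              (ℕ.≤-trans (ℕ.≤-reflexive (≡.sym e)) (≡.subst (size μ ≤_) (≡.sym e′) (ℕ.m≤n+m (size μ) (sum a)))) η≤N)))) (zeroˡ _)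

  antipode-orthogonality : ∀ {N} η → size η ≤ N → ∀ η′ b → Bounded {k} b →
    ∑ (P≤ N) (λ μ → coeff (S (F~/ η μ) *Λ F~/ μ η′) b) ≈ δ η′ η * coeff 1Λ b
  antipode-orthogonality {N} η η≤N η′ b b≤k = begin
    ∑ (P≤ N) (λ μ → coeff (S (F~/ η μ) *Λ F~/ μ η′) b)
      ≈⟨ ∑-map _ (P≤ N) _ ⟨
    ∑ D (λ (f , g) → coeff (S f *Λ g) b)
      ≈⟨ coeff-∑Λ D (λ (f , g) → S f *Λ g) b ⟨
    coeff (∑Λ D (λ (f , g) → S f *Λ g)) b
      ≈⟨ ≈ᵏ⇒≈ k (∑Λ D (λ (f , g) → S f *Λ g)) (ε (F~/ η η′) · 1Λ)
           (IsAntipode.inverseˡ antipode (F~/ η η′) D (≈⇒≈ᵏᵏ (F~/ η η′) D (coassociative η η≤N η′))) b b≤k ⟩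
    coeff (F~/ η η′) [] * coeff 1Λ b
      -- The counit is the coefficient at the empty list, where the matrix coefficient is ⟨ s_η′ ,
      -- F~_η ⟩.
      ≈⟨ *-congʳ (trans (dualSkew-coeff η η′ [] []) (trans
           (Linear.cong (pair-linearˡ (F~ η)) {hˡ [] *Λ s η′} {s η′} (∗-identityˡ (coeff (s η′)))) (dual η′ η))) ⟩
    δ η′ η * coeff 1Λ b ∎
    where D = coproduct-terms N η η′

  -- Such an `f` is congruent to `0# · 0Λ`, whose image under `S` is zero in the quotient by
  -- `scalar`.
  S-vanishes : ∀ f → (∀ b → Bounded {k} b → coeff f b ≈ 0#) → ∀ b → Bounded {k} b → coeff (S f) b ≈ 0#
  S-vanishes f f0 b b≤k = begin
    coeff (S f) b           ≈⟨ ≈ᵏ⇒≈ k (S f) (S (0# · 0Λ)) (IsAntipode.cong antipode (≈⇒≈ᵏ k f (0# · 0Λ)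
                                 (λ a p → trans (f0 a p) (sym (zeroˡ _))))) b b≤k ⟩
    coeff (S (0# · 0Λ)) b   ≈⟨ ≈ᵏ⇒≈ k (S (0# · 0Λ)) (0# · S 0Λ) (IsAntipode.scalar antipode 0# 0Λ) b b≤k ⟩
    0# * coeff (S 0Λ) b     ≈⟨ zeroˡ _ ⟩
    0#                      ∎

  ⟦_⟧ᵇ : List ℕ → Carrier
  ⟦ b ⟧ᵇ = ⟦ bounded? {k} b ⟧

  -- The canonical representative of the kernel modulo Λ₍ₖ₎ ⊗ I
  E : Series₂
  E a b = ⟦ b ⟧ᵇ * coeff (hˡ b) a

  E-bounded : ∀ a b → Bounded {k} b → E a b ≈ coeff (hˡ b) a
  E-bounded a b b≤k = trans (*-congʳ (⟦⟧-yes (bounded? b) b≤k)) (*-identityˡ _)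

  E⋆ : ∀ f a b → (E ⋆ (f ⊗ 1Λ)) a b ≈ ⟦ b ⟧ᵇ * coeff (hˡ b *Λ f) a
  E⋆ f a b = begin
    ∑ˢ a (λ a₁ a₂ → ∑ˢ b (λ b₁ b₂ → E a₁ b₁ * (coeff f a₂ * coeff 1Λ b₂)))
      ≈⟨ ∑ˢ-cong a (λ a₁ a₂ → trans (∑ˢ-cong b (λ b₁ b₂ → trans (*-congˡ (*-comm _ _))
           (trans (sym (*-assoc _ _ _)) (*-comm _ _)))) (sym (*-∑ˢ (coeff f a₂) b _))) ⟩
    ∑ˢ a (λ a₁ a₂ → coeff f a₂ * (E a₁ ∗ coeff 1Λ) b)
      ≈⟨ ∑ˢ-cong a (λ a₁ a₂ → trans (*-congˡ (∗-identityʳ (E a₁) b)) (trans (*-comm _ _) (*-assoc _ _ _))) ⟩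
    ∑ˢ a (λ a₁ a₂ → ⟦ b ⟧ᵇ * (coeff (hˡ b) a₁ * coeff f a₂))
      ≈⟨ *-∑ˢ ⟦ b ⟧ᵇ a _ ⟨
    ⟦ b ⟧ᵇ * coeff (hˡ b *Λ f) a ∎

  E⋆-unbounded : ∀ f a b → ¬ Bounded {k} b → (E ⋆ (f ⊗ 1Λ)) a b ≈ 0#
  E⋆-unbounded f a b ¬p = trans (E⋆ f a b) (trans (*-congʳ (⟦⟧-no (bounded? b) ¬p)) (zeroˡ _))

  E⋆-bounded : ∀ f a b → Bounded {k} b → (E ⋆ (f ⊗ 1Λ)) a b ≈ coeff (hˡ b *Λ f) a
  E⋆-bounded f a b p = trans (E⋆ f a b) (trans (*-congʳ (⟦⟧-yes (bounded? b) p)) (*-identityˡ _))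

  -- T is extended by zero to the unbounded b, where any element of Λ₍ₖ₎ ⊗ Λ may be
  -- changed to zero within Λ₍ₖ₎ ⊗ I.
  zero-extension : ∀ n {T} D → All (Λ₍ₖ₎ k ∘ proj₁) D → (∀ a b → ¬ Bounded {k} b → T a b ≈ 0#) →
                   (∀ a b → sum a ℕ.+ sum b ≡ n → Bounded {k} b → T a b ≈ ⟪ D ⟫ a b) →
                   EqualInDegree k n T (∑₂ D (uncurry _⊗_))
  zero-extension n D D∈ T0 T≈D = equalInDegree n (negate D) (All.map⁺ (All.map (scale (- 1#)) D∈))
    (λ a b e p → trans (T≈D a b e p) (sym (coeff-⟪⟫ D a b)))
    (λ a b e ¬p → trans (T0 a b ¬p) (sym (trans (+-cong (coeff-⟪⟫ D a b) (⟪negate⟫ D a b)) (-‿inverseʳ _))))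

  vanishing-term : ∀ n f g → Λ₍ₖ₎ k f → (∀ a b → sum a ℕ.+ sum b ≡ n → Bounded {k} b → coeff f a * coeff g b ≈ 0#) →
                   EqualInDegree k n (f ⊗ g) 0₂
  vanishing-term n f g f∈ fg0 = equalInDegree n ((f , g) ∷ []) (f∈ ∷ []) fg0
    (λ a b _ _ → sym (trans (+-identityˡ _) (+-identityʳ _)))

  ∑₂-map : ∀ {I : Set} (L : List I) (f g : I → Λ) →
           ∑₂ (map (λ i → f i , g i) L) (uncurry _⊗_) ≡ ∑₂ L (λ i → f i ⊗ g i)
  ∑₂-map []      f g = ≡.refl
  ∑₂-map (i ∷ L) f g = ≡.cong (f i ⊗ g i +₂_) (∑₂-map L f g)

  -- Reduces a sum in the completion to identities between bounded coefficients; at unbounded `b`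
  -- the series T is zero and the terms are absorbed in Λ₍ₖ₎ ⊗ I.
  hasSum : ∀ {I : Set} (f g : I → Λ) → (∀ i → Λ₍ₖ₎ k (f i)) → ∀ {T} → (∀ a b → ¬ Bounded {k} b → T a b ≈ 0#) →
           (∀ n → ∃ λ L → Unique L ×
             (∀ i → i ∉ L → ∀ a b → sum a ℕ.+ sum b ≡ n → Bounded {k} b → coeff (f i) a * coeff (g i) b ≈ 0#) ×
             (∀ a b → sum a ℕ.+ sum b ≡ n → Bounded {k} b → T a b ≈ ∑ L (λ i → coeff (f i) a * coeff (g i) b))) →
           HasSum k (λ i → f i ⊗ g i) T
  hasSum f g f∈ T0 sums n with sums n
  ... | L , !L , out , e = L , !L , (λ i i∉L → vanishing-term n (f i) (g i) (f∈ i) (out i i∉L))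
    , ≡.subst (EqualInDegree k n _) (∑₂-map L f g)
        (zero-extension n (map (λ i → f i , g i) L) (All.map⁺ (All.tabulate (λ {i} _ → f∈ i))) T0
          (λ a b d p → trans (e a b d p) (sym (∑-map (λ i → f i , g i) L _))))

  -- A Cauchy identity read at y^b: the coordinate of h_b at s_β is ⟨ h_b , F~_β ⟩, the coefficient
  -- of y^b in F~_β. Homogeneity of s_β removes the labels larger than `n`.
  kernel-sum : HasSum k (λ β → s β ⊗ F~ β) E
  kernel-sum = hasSum s F~ (IsBasisOfΛ₍ₖ₎.member (IsKSchur.basis kSchur))
    (λ a b ¬p → trans (*-congʳ (⟦⟧-no (bounded? b) ¬p)) (zeroˡ _))
    (λ n → P≤ n , boundedPartitions-unique n
      , (λ β β∉ a b e _ → trans (*-congʳ (s-homogeneous β a (λ q → ℕ.<⇒≱ (∉-boundedPartitions β β∉)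
          (≡.subst (_≤ n) q (≡.subst (sum a ≤_) e (ℕ.m≤m+n (sum a) (sum b))))))) (zeroˡ _))
      , (λ a b e p → begin
          E a b
            ≈⟨ E-bounded a b p ⟩
          coeff (hˡ b) a
            ≈⟨ s-expansion (_≡ sum b) (HSpan⇒SSpan (_≡ sum b) (base (b , p , ≡.refl)))
                 (λ q → ≡.subst (_≤ n) (≡.sym q) (≡.subst (sum b ≤_) e (ℕ.m≤n+m (sum b) (sum a)))) a ⟩
          ∑ (P≤ n) (λ β → ⟨ hˡ b , F~ β ⟩ * coeff (s β) a)
            ≈⟨ ∑-cong (P≤ n) (λ β → trans (*-congʳ (pair-hˡ b (F~ β))) (*-comm _ _)) ⟩
          ∑ (P≤ n) (λ β → coeff (s β) a * coeff (F~ β) b) ∎))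

  module _ (la η : BP) where

    term : BP × BP → Λ
    term (ρ , μ) = S (F~/ η μ) *Λ F~/ ρ la

    product-vanishesˡ : ∀ f g → (∀ b → Bounded {k} b → coeff f b ≈ 0#) → ∀ b → Bounded {k} b → coeff (f *Λ g) b ≈ 0#
    product-vanishesˡ f g f0 b p = trans (∑-congᴬ (All.map
      (λ {(b₁ , b₂)} (p₁ , _) → trans (*-congʳ (f0 b₁ p₁)) (zeroˡ _)) (splits-≤ b p))) (∑-0 (splits b))

    -- If |μ| > |η|, then F~_{η/μ} is zero in the quotient, and so is its antipode. A large ρ is
    -- excluded through the degree of F~_{ρ/λ} alone: whatever `S` contributes, this factor is
    -- evaluated at a divisor of y^b.
    outside : ∀ {n N} → n ℕ.+ size la ≤ N → size η ≤ N → ∀ ρ μ → N < size ρ ⊎ N < size μ →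
              ∀ b → sum b ≤ n → Bounded {k} b → coeff (term (ρ , μ)) b ≈ 0#
    outside la≤N η≤N ρ μ (inj₂ N<μ) b b≤n p = product-vanishesˡ (S (F~/ η μ)) (F~/ ρ la) (S-vanishes (F~/ η μ) (λ c q →
      dualSkew-vanishes η μ c q (λ e → ℕ.<⇒≱ N<μ (ℕ.≤-trans
        (≡.subst (size μ ≤_) (≡.sym e) (ℕ.m≤n+m (size μ) (sum c))) η≤N)))) b p
    outside {n} la≤N η≤N ρ μ (inj₁ N<ρ) b b≤n p = trans (∑-congᴬ (All.map
      (λ {(b₁ , b₂)} ((_ , p₂) , e) → trans (*-congˡ (dualSkew-vanishes ρ la b₂ p₂ (λ e′ → ℕ.<⇒≱ N<ρ
        (≡.subst (_≤ _) (≡.sym e′) (ℕ.≤-trans (ℕ.+-monoˡ-≤ (size la)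
          (ℕ.≤-trans (≡.subst (sum b₂ ≤_) e (ℕ.m≤n+m (sum b₂) (sum b₁))) b≤n)) la≤N))))) (zeroʳ _))
      (All.zip (splits-≤ b p , splits-sum b)))) (∑-0 (splits b))

    identity : ∀ {n N} → n ℕ.+ size la ≤ N → size η ≤ N → ∀ a b → sum b ≤ n → Bounded {k} b →
               coeff (hˡ b *Λ s/ la η) a ≈
               ∑ (P≤ N) (λ ρ → ∑ (P≤ N) (λ μ → coeff (s/ ρ μ) a * coeff (term (ρ , μ)) b))
    identity {n} {N} la≤N η≤N a b b≤n p = sym (begin
      ∑ (P≤ N) (λ ρ → ∑ (P≤ N) (λ μ → coeff (s/ ρ μ) a * coeff (term (ρ , μ)) b))
        ≈⟨ ∑-swap (P≤ N) (P≤ N) _ ⟩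
      ∑ (P≤ N) (λ μ → ∑ (P≤ N) (λ ρ → coeff (s/ ρ μ) a * coeff (term (ρ , μ)) b))
        ≈⟨ ∑-cong (P≤ N) (λ μ → sym (trans (∗-∑ (coeff (S (F~/ η μ))) (P≤ N) _ b)
             (∑-cong (P≤ N) (λ ρ → ∗-* (coeff (S (F~/ η μ))) (coeff (s/ ρ μ) a) (coeff (F~/ ρ la)) b)))) ⟩
      ∑ (P≤ N) (λ μ → (coeff (S (F~/ η μ)) ∗ (λ c → ∑ (P≤ N) (λ ρ → coeff (s/ ρ μ) a * coeff (F~/ ρ la) c))) b)
        -- `exchange` is used at each factor b₂ of b, which is bounded and no larger than b; the
        -- same cutoff `N` serves for ρ and η′.
        ≈⟨ ∑-cong (P≤ N) (λ μ → ∑-congᴬ (All.map (λ {(b₁ , b₂)} ((_ , p₂) , e) → *-congˡ (trans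
             (∑-cong (P≤ N) (λ ρ → *-comm _ _))
             (exchange b₂ p₂ la (≤N (≡.subst (sum b₂ ≤_) e (ℕ.m≤n+m (sum b₂) (sum b₁)))) (ℕ.m+n≤o⇒n≤o n la≤N) μ a)))
             (All.zip (splits-≤ b p , splits-sum b)))) ⟩
      ∑ (P≤ N) (λ μ → (coeff (S (F~/ η μ)) ∗ (λ c → ∑ (P≤ N) (λ η′ → (w η′ ∗ coeff (F~/ μ η′)) c))) b)
        -- Moving `w η′` to the front brings S(F~_{η/μ}) next to F~_{μ/η′}, ready for the sum over
        -- μ.
        ≈⟨ ∑-cong (P≤ N) (λ μ → trans (∗-∑ (coeff (S (F~/ η μ))) (P≤ N) _ b)
             (∑-cong (P≤ N) (λ η′ → ∗-leftComm (coeff (S (F~/ η μ))) (w η′) (coeff (F~/ μ η′)) b))) ⟩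
      ∑ (P≤ N) (λ μ → ∑ (P≤ N) (λ η′ → (w η′ ∗ coeff (S (F~/ η μ) *Λ F~/ μ η′)) b))
        ≈⟨ ∑-swap (P≤ N) (P≤ N) _ ⟩
      ∑ (P≤ N) (λ η′ → ∑ (P≤ N) (λ μ → (w η′ ∗ coeff (S (F~/ η μ) *Λ F~/ μ η′)) b))
        ≈⟨ ∑-cong (P≤ N) (λ η′ → ∗-∑ (w η′) (P≤ N) (λ μ → coeff (S (F~/ η μ) *Λ F~/ μ η′)) b) ⟨
      ∑ (P≤ N) (λ η′ → (w η′ ∗ (λ c → ∑ (P≤ N) (λ μ → coeff (S (F~/ η μ) *Λ F~/ μ η′) c))) b)
        ≈⟨ ∑-cong (P≤ N) (λ η′ → ∑-congᴬ (All.map (λ {(b₁ , b₂)} (_ , p₂) →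
             *-congˡ (antipode-orthogonality η η≤N η′ b₂ p₂)) (splits-≤ b p))) ⟩
      ∑ (P≤ N) (λ η′ → (w η′ ∗ (λ c → δ η′ η * coeff 1Λ c)) b)
        ≈⟨ ∑-cong (P≤ N) (λ η′ → trans (∗-* (w η′) (δ η′ η) (coeff 1Λ) b)
             (*-cong (δ-sym η′ η) (∗-identityʳ (w η′) b))) ⟩
      ∑ (P≤ N) (λ η′ → δ η η′ * w η′ b)
        ≈⟨ ∑-δ (boundedPartitions-unique N) (∈-boundedPartitions η η≤N) (λ η′ → w η′ b) ⟩
      coeff (hˡ b *Λ s/ la η) a ∎)
      where
      -- At bounded `c`, the coefficient of x^a y^c in E[X|Y] s_{λ/η′}[X].
      w : BP → Series
      w η′ c = coeff (hˡ c *Λ s/ la η′) a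
      ≤N : ∀ {d} → d ≤ sum b → d ℕ.+ size la ≤ N
      ≤N d≤b = ℕ.≤-trans (ℕ.+-monoˡ-≤ (size la) (ℕ.≤-trans d≤b b≤n)) la≤N

    reproducing-sum : HasSum k {I = BP × BP} (λ (ρ , μ) → s/ ρ μ ⊗ (S (F~/ η μ) *Λ F~/ ρ la))
                      (E ⋆ (s/ la η ⊗ 1Λ))
    reproducing-sum = hasSum (uncurry s/) term (λ (ρ , μ) → proj₁ skew ρ μ) (E⋆-unbounded (s/ la η)) (λ n →
      -- `n + size la` covers every ρ for which F~_{ρ/λ} reaches degree at most `n`, and `size η`
      -- covers every μ for which F~_{η/μ} is nonzero in the quotient.
      let N = n ℕ.+ size la ℕ.+ size η
          la≤N : n ℕ.+ size la ≤ N
          la≤N = ℕ.m≤m+n _ (size η)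
          η≤N : size η ≤ N
          η≤N = ℕ.m≤n+m (size η) _
          b≤n : ∀ (a b : List ℕ) → sum a ℕ.+ sum b ≡ n → sum b ≤ n
          b≤n a b e = ≡.subst (sum b ≤_) e (ℕ.m≤n+m (sum b) (sum a))
      in cartesianProduct (P≤ N) (P≤ N)
        , cartesianProduct⁺ (boundedPartitions-unique N) (boundedPartitions-unique N)
        , (λ (ρ , μ) ∉L a b e p → trans (*-congˡ (outside la≤N η≤N ρ μ (large ρ μ ∉L) b (b≤n a b e) p)) (zeroʳ _))
        , (λ a b e p → trans (E⋆-bounded (s/ la η) a b p) (trans (identity la≤N η≤N a b (b≤n a b e) p)
            (sym (∑-cartesianProduct (P≤ N) (P≤ N) _)))))
      where
      large : ∀ {N} ρ μ → (ρ , μ) ∉ cartesianProduct (P≤ N) (P≤ N) → N < size ρ ⊎ N < size μ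
      large {N} ρ μ ∉L with size ρ ℕ.≤? N
      ... | no  ρ≰N = inj₁ (ℕ.≰⇒> ρ≰N)
      ... | yes ρ≤N = inj₂ (∉-boundedPartitions μ (λ μ∈ → ∉L (∈-cartesianProduct⁺ (∈-boundedPartitions ρ ρ≤N) μ∈)))

theorem5p4 : ∀ {c ℓ} (F : CommutativeRing c ℓ) → IsFieldOfCharZero F →
  let open CommutativeRing F using (_≈_) renaming (Carrier to |F|)
      open SymmetricFunctions F in
  (k : ℕ) → 1 ≤ k →
  (⟨_,_⟩ : Λ → Λ → |F|) → IsHallPairing ⟨_,_⟩ →
  (S : Λ → Λ) → IsAntipode k S →
  (s : BoundedPartition k → Λ) → IsKSchur k s →
  (F~ : BoundedPartition k → Λ) → (∀ la mu → ⟨ s la , F~ mu ⟩ ≈ δ la mu) →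
  (s/ : BoundedPartition k → BoundedPartition k → Λ) → IsSkewKSchur k s s/ →
  (F~/ : BoundedPartition k → BoundedPartition k → Λ) → IsSkewDualKSchur k F~ F~/ →
  Σ Series₂ λ E →
    HasSum k (λ la → s la ⊗ F~ la) E ×
    (∀ la eta →
      HasSum k {I = BoundedPartition k × BoundedPartition k}
        (λ (rho , mu) → s/ rho mu ⊗ (S (F~/ eta mu) *Λ F~/ rho la))
        (E ⋆ (s/ la eta ⊗ 1Λ)))
theorem5p4 F _ k _ ⟨_,_⟩ hall S antipode s kSchur F~ dual s/ skew F~/ dualSkew =
  R.E , R.kernel-sum , R.reproducing-sum
  where module R = Reproducing F k ⟨_,_⟩ hall S antipode s kSchur F~ dual s/ skew F~/ dualSkew
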